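{- Let $\sigma=t_1t_2\cdots t_n$ be a sequence with each $t_i\in\{\mathtt{A^*},\mathtt{A^+},\mathtt{A^- },\mathtt{N},\mathtt{S^*},\mathtt{S^+},\mathtt{S^- }\}$, with underlying epr-sequence $\ell_1\ell_2\cdots\ell_n$. Suppose $\ell_{k-1}\ell_k\ell_{k+1}=\mathtt{ANA}$, where $2\le k\le n-2$. Let $\alpha=\{1,\dots,n-1\}\setminus\{k-1,k\}$. Then there exists an $n\times n$ real symmetric matrix $B$ with $\operatorname{sepr}(B)=\sigma$ if and only if one of the following holds: (1) $\sigma=\overline{\mathtt{A^+}}\,\mathtt{A^+NA^-A^- }\,\overline{\mathtt{A^- }}$; (2) $k$ is odd, $t_{k-1}t_kt_{k+1}t_{k+2}=\mathtt{A^+NA^-A^+}$, and $t_{i+1}=\operatorname{neg}(t_i)$ for all $i\in\alpha$; (3) $k$ is even, $t_{k-1}t_kt_{k+1}t_{k+2}=\mathtt{A^-NA^+A^- }$, and $t_{i+1}=\operatorname{neg}(t_i)$ for all $i\in\alpha$.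
   Context: A principal minor of order $k$ of an $n\times n$ matrix is the determinant of a $k\times k$ principal submatrix (same row and column index set). The signed enhanced principal rank characteristic sequence (sepr-sequence) of an $n\times n$ complex Hermitian matrix $B$ is $\operatorname{sepr}(B)=t_1t_2\cdots t_n$, where: $t_k=\mathtt{A^*}$ if all order-$k$ principal minors are nonzero and there are both a positive and a negative one; $t_k=\mathtt{A^+}$ (resp. $\mathtt{A^- }$) if all order-$k$ principal minors are positive (resp. negative); $t_k=\mathtt{N}$ if all are zero; $t_k=\mathtt{S^*}$ if there are a positive, a negative and a zero order-$k$ principal minor; $t_k=\mathtt{S^+}$ (resp. $\mathtt{S^- }$) if there are both a zero and a nonzero order-$k$ principal minor, and every nonzero one is positive (resp. negative). The underlying epr-sequence $\ell_1\cdots\ell_n$ of a sequence in these symbols is obtained by deleting the superscripts, so each $\ell_i\in\{\mathtt{A},\mathtt{N},\mathtt{S}\}$. The operation $\operatorname{neg}$ interchanges the superscripts $+$ and $-$ and leaves $\mathtt{A^*},\mathtt{S^*},\mathtt{N}$ unchanged. An overlined term, such as $\overline{\mathtt{A^+}}$, means that the term may be repeated any number of times, including zero times. -}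

module Defs where

open import Algebra.Bundles.Raw using (RawRing)
import Algebra.Definitions.RawSemiring as RawSemiringDefinitions
open import Data.Fin.Base using (Fin; zero; suc; toℕ; punchIn)
open import Data.Fin.Subset using (Subset; inside; outside; ∣_∣)
open import Data.List.Base using (List; []; _∷_; _++_; replicate)
open import Data.Maybe.Base using (Maybe; just; nothing; map)
open import Data.Nat.Base as ℕ using (ℕ; zero; suc)
import Data.Nat.Properties as ℕ
open import Data.Product.Base using (∃; ∃-syntax; _×_; _,_)
open import Data.Rational.Base as ℚ using (ℚ; 0ℚ; 1ℚ; ½)
import Data.Rational.Properties as ℚ
open import Data.Rational.Solver using (module +-*-Solver)
open import Data.Vec.Base as Vec using (Vec; []; _∷_; toList)
open import Level using (0ℓ)
open import Relation.Binary.PropositionalEquality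
  using (_≡_; refl; sym; cong; cong₂; subst)
open import Relation.Nullary.Negation using (¬_)

------------------------------------------------------------------------
-- The real numbers: Cauchy sequences of rationals under the setoid
-- equality _≃_.

∣_-_∣ : ℚ → ℚ → ℚ
∣ p - q ∣ = ℚ.∣ p ℚ.- q ∣

Cauchy : (ℕ → ℚ) → Set
Cauchy x = ∀ ε → 0ℚ ℚ.< ε →
  ∃[ N ] (∀ m n → N ℕ.≤ m → N ℕ.≤ n → ∣ x m - x n ∣ ℚ.< ε)

record ℝ : Set where
  no-eta-equality
  constructor mkℝ
  field
    seq    : ℕ → ℚ
    cauchy : Cauchy seq

open ℝ public

infix 4 _≃_ _<_

record _≃_ (x y : ℝ) : Set where
  constructor mk≃
  field
    close : ∀ ε → 0ℚ ℚ.< ε →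
      ∃[ N ] (∀ m → N ℕ.≤ m → ∣ seq x m - seq y m ∣ ℚ.< ε)

-- A uniform gap is required: eventual termwise ℚ._<_ would not be
-- invariant under _≃_.
record _<_ (x y : ℝ) : Set where
  constructor mk<
  field
    gap       : ℚ
    gap>0     : 0ℚ ℚ.< gap
    separated : ∃[ N ] (∀ m → N ℕ.≤ m → seq x m ℚ.+ gap ℚ.< seq y m)

private
  open ℚ.≤-Reasoning

  Bounded : (ℕ → ℚ) → Set
  Bounded x = ∃[ K ] (0ℚ ℚ.< K ×
    ∃[ N ] (∀ m → N ℕ.≤ m → ℚ.∣ x m ∣ ℚ.≤ K))

  abstract
    ε/2>0 : ∀ {ε} → 0ℚ ℚ.< ε → 0ℚ ℚ.< ½ ℚ.* ε
    ε/2>0 {ε} ε>0 = subst (ℚ._< ½ ℚ.* ε) (ℚ.*-zeroʳ ½) (ℚ.*-monoʳ-<-pos ½ ε>0)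

    ε/2+ε/2 : ∀ ε → ½ ℚ.* ε ℚ.+ ½ ℚ.* ε ≡ ε
    ε/2+ε/2 ε = begin-equality
      ½ ℚ.* ε ℚ.+ ½ ℚ.* ε  ≡⟨ sym (ℚ.*-distribʳ-+ ε ½ ½) ⟩
      1ℚ ℚ.* ε             ≡⟨ ℚ.*-identityˡ ε ⟩
      ε                    ∎

    +-split : ∀ a b c d →
      (a ℚ.+ b) ℚ.- (c ℚ.+ d) ≡ (a ℚ.- c) ℚ.+ (b ℚ.- d)
    +-split = solve 4 (λ a b c d →
      (a :+ b) :- (c :+ d) := (a :- c) :+ (b :- d)) refl
      where open +-*-Solver

    *-split : ∀ a b c d →
      a ℚ.* b ℚ.- c ℚ.* d ≡ a ℚ.* (b ℚ.- d) ℚ.+ d ℚ.* (a ℚ.- c)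
    *-split = solve 4 (λ a b c d →
      a :* b :- c :* d := a :* (b :- d) :+ d :* (a :- c)) refl
      where open +-*-Solver

    neg-split : ∀ a b → (ℚ.- a) ℚ.- (ℚ.- b) ≡ ℚ.- (a ℚ.- b)
    neg-split = solve 2 (λ a b → (:- a) :- (:- b) := :- (a :- b)) refl
      where open +-*-Solver

    restore : ∀ a b → a ≡ (a ℚ.- b) ℚ.+ b
    restore = solve 2 (λ a b → a := (a :- b) :+ b) refl
      where open +-*-Solver

    Cauchy-const : ∀ q → Cauchy (λ _ → q)
    Cauchy-const q ε ε>0 = 0 , λ _ _ _ _ →
      subst (λ z → ℚ.∣ z ∣ ℚ.< ε) (sym (ℚ.+-inverseʳ q)) ε>0

    Cauchy-neg : ∀ {x} → Cauchy x → Cauchy (λ n → ℚ.- x n)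
    Cauchy-neg {x} cx ε ε>0 with cx ε ε>0
    ... | N , near = N , λ m n N≤m N≤n → begin-strict
      ∣ (ℚ.- x m) - (ℚ.- x n) ∣  ≡⟨ cong ℚ.∣_∣ (neg-split (x m) (x n)) ⟩
      ℚ.∣ ℚ.- (x m ℚ.- x n) ∣    ≡⟨ ℚ.∣-p∣≡∣p∣ (x m ℚ.- x n) ⟩
      ∣ x m - x n ∣              <⟨ near m n N≤m N≤n ⟩
      ε                          ∎

    Cauchy-+ : ∀ {x y} → Cauchy x → Cauchy y → Cauchy (λ n → x n ℚ.+ y n)
    Cauchy-+ {x} {y} cx cy ε ε>0
      with cx (½ ℚ.* ε) (ε/2>0 ε>0) | cy (½ ℚ.* ε) (ε/2>0 ε>0)
    ... | M , nearx | N , neary = M ℕ.⊔ N , λ m n p q → begin-strict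
      ∣ x m ℚ.+ y m - (x n ℚ.+ y n) ∣
        ≡⟨ cong ℚ.∣_∣ (+-split (x m) (y m) (x n) (y n)) ⟩
      ℚ.∣ (x m ℚ.- x n) ℚ.+ (y m ℚ.- y n) ∣
        ≤⟨ ℚ.∣p+q∣≤∣p∣+∣q∣ (x m ℚ.- x n) (y m ℚ.- y n) ⟩
      ∣ x m - x n ∣ ℚ.+ ∣ y m - y n ∣
        <⟨ ℚ.+-mono-<
             (nearx m n (ℕ.m⊔n≤o⇒m≤o M N p) (ℕ.m⊔n≤o⇒m≤o M N q))
             (neary m n (ℕ.m⊔n≤o⇒n≤o M N p) (ℕ.m⊔n≤o⇒n≤o M N q)) ⟩
      ½ ℚ.* ε ℚ.+ ½ ℚ.* ε
        ≡⟨ ε/2+ε/2 ε ⟩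
      ε ∎

    1>0 : 0ℚ ℚ.< 1ℚ
    1>0 = ℚ.positive⁻¹ 1ℚ

    Cauchy⇒Bounded : ∀ {x} → Cauchy x → Bounded x
    Cauchy⇒Bounded {x} cx with cx 1ℚ 1>0
    ... | N , near =
      1ℚ ℚ.+ ℚ.∣ x N ∣ , ℚ.+-mono-<-≤ 1>0 (ℚ.0≤∣p∣ (x N)) , N , λ m N≤m → begin
        ℚ.∣ x m ∣                    ≡⟨ cong ℚ.∣_∣ (restore (x m) (x N)) ⟩
        ℚ.∣ (x m ℚ.- x N) ℚ.+ x N ∣  ≤⟨ ℚ.∣p+q∣≤∣p∣+∣q∣ (x m ℚ.- x N) (x N) ⟩
        ∣ x m - x N ∣ ℚ.+ ℚ.∣ x N ∣  ≤⟨ ℚ.+-monoˡ-≤ ℚ.∣ x N ∣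
                                          (ℚ.<⇒≤ (near m N N≤m ℕ.≤-refl)) ⟩
        1ℚ ℚ.+ ℚ.∣ x N ∣             ∎

    -- A δ with K δ = ε / 2.
    scale : ∀ K → 0ℚ ℚ.< K → ∀ ε → 0ℚ ℚ.< ε →
            ∃[ δ ] (0ℚ ℚ.< δ × K ℚ.* δ ≡ ½ ℚ.* ε)
    scale K K>0 ε ε>0 =
      K⁻¹ ℚ.* (½ ℚ.* ε) ,
      subst (ℚ._< K⁻¹ ℚ.* (½ ℚ.* ε)) (ℚ.*-zeroʳ K⁻¹) (ℚ.*-monoʳ-<-pos K⁻¹ (ε/2>0 ε>0)) ,
      (begin-equality
        K ℚ.* (K⁻¹ ℚ.* (½ ℚ.* ε))  ≡⟨ sym (ℚ.*-assoc K K⁻¹ (½ ℚ.* ε)) ⟩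
        K ℚ.* K⁻¹ ℚ.* (½ ℚ.* ε)    ≡⟨ cong (ℚ._* (½ ℚ.* ε)) (ℚ.*-inverseʳ K) ⟩
        1ℚ ℚ.* (½ ℚ.* ε)           ≡⟨ ℚ.*-identityˡ (½ ℚ.* ε) ⟩
        ½ ℚ.* ε                    ∎)
      where
      instance
        K-pos : ℚ.Positive K
        K-pos = ℚ.positive K>0
        K-nonZero : ℚ.NonZero K
        K-nonZero = ℚ.pos⇒nonZero K
      K⁻¹ : ℚ
      K⁻¹ = ℚ.1/ K
      instance
        K⁻¹-pos : ℚ.Positive K⁻¹
        K⁻¹-pos = ℚ.1/pos⇒pos K

    bound : ∀ {K δ} → 0ℚ ℚ.< K → ∀ a b →
            ℚ.∣ a ∣ ℚ.≤ K → ℚ.∣ b ∣ ℚ.< δ → ℚ.∣ a ℚ.* b ∣ ℚ.< K ℚ.* δ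
    bound {K} {δ} K>0 a b a≤K b<δ = begin-strict
      ℚ.∣ a ℚ.* b ∣          ≡⟨ ℚ.∣p*q∣≡∣p∣*∣q∣ a b ⟩
      ℚ.∣ a ∣ ℚ.* ℚ.∣ b ∣    ≤⟨ ℚ.*-monoʳ-≤-nonNeg ℚ.∣ b ∣
                                  {{ℚ.nonNegative (ℚ.0≤∣p∣ b)}} a≤K ⟩
      K ℚ.* ℚ.∣ b ∣          <⟨ ℚ.*-monoʳ-<-pos K {{ℚ.positive K>0}} b<δ ⟩
      K ℚ.* δ                ∎

    *-near : ∀ {K L δ η ε} → 0ℚ ℚ.< K → 0ℚ ℚ.< L →
             K ℚ.* δ ≡ ½ ℚ.* ε → L ℚ.* η ≡ ½ ℚ.* ε → ∀ a b c d →
             ℚ.∣ a ∣ ℚ.≤ K → ℚ.∣ d ∣ ℚ.≤ L →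
             ∣ b - d ∣ ℚ.< δ → ∣ a - c ∣ ℚ.< η →
             ∣ a ℚ.* b - c ℚ.* d ∣ ℚ.< ε
    *-near {K} {L} {δ} {η} {ε} K>0 L>0 Kδ Lη a b c d a≤K d≤L b≈d a≈c =
      begin-strict
        ∣ a ℚ.* b - c ℚ.* d ∣
          ≡⟨ cong ℚ.∣_∣ (*-split a b c d) ⟩
        ℚ.∣ a ℚ.* (b ℚ.- d) ℚ.+ d ℚ.* (a ℚ.- c) ∣
          ≤⟨ ℚ.∣p+q∣≤∣p∣+∣q∣ (a ℚ.* (b ℚ.- d)) (d ℚ.* (a ℚ.- c)) ⟩
        ℚ.∣ a ℚ.* (b ℚ.- d) ∣ ℚ.+ ℚ.∣ d ℚ.* (a ℚ.- c) ∣
          <⟨ ℚ.+-mono-< (bound K>0 a (b ℚ.- d) a≤K b≈d)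
                        (bound L>0 d (a ℚ.- c) d≤L a≈c) ⟩
        K ℚ.* δ ℚ.+ L ℚ.* η
          ≡⟨ cong₂ ℚ._+_ Kδ Lη ⟩
        ½ ℚ.* ε ℚ.+ ½ ℚ.* ε
          ≡⟨ ε/2+ε/2 ε ⟩
        ε ∎

    Cauchy-* : ∀ {x y} → Cauchy x → Cauchy y → Cauchy (λ n → x n ℚ.* y n)
    Cauchy-* {x} {y} cx cy ε ε>0 =
      let K , K>0 , A , x≤K = Cauchy⇒Bounded cx
          L , L>0 , B , y≤L = Cauchy⇒Bounded cy
          δ , δ>0 , Kδ      = scale K K>0 ε ε>0
          η , η>0 , Lη      = scale L L>0 ε ε>0
          C , neary         = cy δ δ>0
          D , nearx         = cx η η>0
      in (A ℕ.⊔ B) ℕ.⊔ (C ℕ.⊔ D) , λ m n p q →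
        let p₁ = ℕ.m⊔n≤o⇒m≤o (A ℕ.⊔ B) (C ℕ.⊔ D) p
            p₂ = ℕ.m⊔n≤o⇒n≤o (A ℕ.⊔ B) (C ℕ.⊔ D) p
            q₁ = ℕ.m⊔n≤o⇒m≤o (A ℕ.⊔ B) (C ℕ.⊔ D) q
            q₂ = ℕ.m⊔n≤o⇒n≤o (A ℕ.⊔ B) (C ℕ.⊔ D) q
        in *-near K>0 L>0 Kδ Lη (x m) (y m) (x n) (y n)
             (x≤K m (ℕ.m⊔n≤o⇒m≤o A B p₁))
             (y≤L n (ℕ.m⊔n≤o⇒n≤o A B q₁))
             (neary m n (ℕ.m⊔n≤o⇒m≤o C D p₂) (ℕ.m⊔n≤o⇒m≤o C D q₂))
             (nearx m n (ℕ.m⊔n≤o⇒n≤o C D p₂) (ℕ.m⊔n≤o⇒n≤o C D q₂))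

fromℚ : ℚ → ℝ
seq    (fromℚ q) _ = q
cauchy (fromℚ q)   = Cauchy-const q

infixl 7 _*ᴿ_
infixl 6 _+ᴿ_
infix  8 -ᴿ_

_+ᴿ_ _*ᴿ_ : ℝ → ℝ → ℝ
seq    (x +ᴿ y) n = seq x n ℚ.+ seq y n
cauchy (x +ᴿ y)   = Cauchy-+ {seq x} {seq y} (cauchy x) (cauchy y)
seq    (x *ᴿ y) n = seq x n ℚ.* seq y n
cauchy (x *ᴿ y)   = Cauchy-* {seq x} {seq y} (cauchy x) (cauchy y)

-ᴿ_ : ℝ → ℝ
seq    (-ᴿ x) n = ℚ.- seq x n
cauchy (-ᴿ x)   = Cauchy-neg {seq x} (cauchy x)

0ℝ 1ℝ : ℝ
0ℝ = fromℚ 0ℚ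
1ℝ = fromℚ 1ℚ

ℝ-rawRing : RawRing 0ℓ 0ℓ
ℝ-rawRing = record
  { Carrier = ℝ
  ; _≈_     = _≃_
  ; _+_     = _+ᴿ_
  ; _*_     = _*ᴿ_
  ; -_      = -ᴿ_
  ; 0#      = 0ℝ
  ; 1#      = 1ℝ
  }

------------------------------------------------------------------------
-- Matrices and principal minors

Matrix : ∀ {a} → Set a → ℕ → Set a
Matrix A n = Fin n → Fin n → A

module _ {c ℓ} (R : RawRing c ℓ) where
  open RawRing R
  open RawSemiringDefinitions rawSemiring using (sum; _^_)

  -- Laplace expansion along the first row.
  det : ∀ {n} → Matrix Carrier n → Carrier
  det {zero}  M = 1#
  det {suc n} M = sum λ j →
    (- 1#) ^ toℕ j * (M zero j * det λ i k → M (suc i) (punchIn j k))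

-- The increasing enumeration of the elements of a subset.
enum : ∀ {n} (α : Subset n) → Fin ∣ α ∣ → Fin n
enum (outside ∷ α) i       = suc (enum α i)
enum (inside  ∷ α) zero    = zero
enum (inside  ∷ α) (suc i) = suc (enum α i)

principalSubmatrix : ∀ {a n} {X : Set a} →
  Matrix X n → (α : Subset n) → Matrix X ∣ α ∣
principalSubmatrix B α i j = B (enum α i) (enum α j)

minor : ∀ {n} → Matrix ℝ n → Subset n → ℝ
minor B α = det ℝ-rawRing (principalSubmatrix B α)

Symmetric : ∀ {n} → Matrix ℝ n → Set
Symmetric B = ∀ i j → B i j ≃ B j i

------------------------------------------------------------------------
-- sepr-sequences

data SeprTerm : Set where
  A* A⁺ A⁻ N S* S⁺ S⁻ : SeprTerm

data EprTerm : Set where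
  A N S : EprTerm

underlying : SeprTerm → EprTerm
underlying A* = A
underlying A⁺ = A
underlying A⁻ = A
underlying N  = N
underlying S* = S
underlying S⁺ = S
underlying S⁻ = S

epr : ∀ {n} → Vec SeprTerm n → Vec EprTerm n
epr = Vec.map underlying

neg : SeprTerm → SeprTerm
neg A* = A*
neg A⁺ = A⁻
neg A⁻ = A⁺
neg N  = N
neg S* = S*
neg S⁺ = S⁻
neg S⁻ = S⁺

Zero NonZero Positive Negative : ℝ → Set
Zero     x = x ≃ 0ℝ
NonZero  x = ¬ Zero x
Positive x = 0ℝ < x
Negative x = x < 0ℝ

module _ {n} (B : Matrix ℝ n) (k : ℕ) where

  AllMinors SomeMinor : (ℝ → Set) → Set
  AllMinors P = ∀ (α : Subset n) → ∣ α ∣ ≡ k → P (minor B α)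
  SomeMinor P = ∃[ α ] (∣ α ∣ ≡ k × P (minor B α))

  HasTerm : SeprTerm → Set
  HasTerm A* = AllMinors NonZero × SomeMinor Positive × SomeMinor Negative
  HasTerm A⁺ = AllMinors Positive
  HasTerm A⁻ = AllMinors Negative
  HasTerm N  = AllMinors Zero
  HasTerm S* = SomeMinor Positive × SomeMinor Negative × SomeMinor Zero
  HasTerm S⁺ = SomeMinor Zero × SomeMinor NonZero ×
               AllMinors (λ x → NonZero x → Positive x)
  HasTerm S⁻ = SomeMinor Zero × SomeMinor NonZero ×
               AllMinors (λ x → NonZero x → Negative x)

-- sepr(B) = σ.  This is a relation because the sign of a real number
-- cannot be computed; for 1 ≤ k ≤ n at most one term satisfies
-- HasTerm B k, so B has at most one sequence.
HasSepr : ∀ {n} → Matrix ℝ n → Vec SeprTerm n → Set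
HasSepr B σ = ∀ i → HasTerm B (suc (toℕ i)) (Vec.lookup σ i)

infix 8 _‼_

-- The i-th term, counting from 1; nothing if i is out of range.
_‼_ : ∀ {a n} {X : Set a} → Vec X n → ℕ → Maybe X
_       ‼ zero        = nothing
[]      ‼ suc i       = nothing
(x ∷ v) ‼ suc zero    = just x
(x ∷ v) ‼ suc (suc i) = v ‼ suc i

-- α = {1,…,n-1} ∖ {k-1,k}
_∈α[_,_] : ℕ → ℕ → ℕ → Set
i ∈α[ n , k ] =
  1 ℕ.≤ i × i ℕ.≤ n ℕ.∸ 1 × ¬ (i ≡ k ℕ.∸ 1) × ¬ (i ≡ k)

NegatesOffANA : ∀ {n} → Vec SeprTerm n → ℕ → Set
NegatesOffANA {n} σ k = ∀ i → i ∈α[ n , k ] → σ ‼ suc i ≡ map neg (σ ‼ i)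

HasBlock : ∀ {n} → Vec SeprTerm n → ℕ →
           SeprTerm → SeprTerm → SeprTerm → SeprTerm → Set
HasBlock σ k t u v w =
  σ ‼ (k ℕ.∸ 1) ≡ just t × σ ‼ k ≡ just u ×
  σ ‼ (k ℕ.+ 1) ≡ just v × σ ‼ (k ℕ.+ 2) ≡ just w

-- Each overlined term is repeated an independent, possibly zero, number
-- of times.
IsA⁺NA⁻A⁻ : ∀ {n} → Vec SeprTerm n → Set
IsA⁺NA⁻A⁻ σ = ∃[ a ] ∃[ b ]
  toList σ ≡ replicate a A⁺ ++ (A⁺ ∷ N ∷ A⁻ ∷ A⁻ ∷ []) ++ replicate b A⁻

{-# OPTIONS --safe #-}

-- Let M be a principal submatrix of order k + 2 and G = adj M.  The
-- cofactors of row j of M with the index i removed form a vector u with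
-- M u = Gᵢᵢ eⱼ - Gᵢⱼ eᵢ.  Pairing such vectors through the symmetric M
-- gives Gᵢᵢ Gⱼⱼ = Gᵢⱼ² and, as no entry of u off {i, j} vanishes,
-- Gᵢᵢ Gⱼⱼ Gₗₗ = - Gᵢⱼ Gⱼₗ Gₗᵢ.  Thus G is 2 W² - w wᵀ up to a factor,
-- where W = diag w, so that M, and then all of B, is diagonally congruent
-- to ± (k I - J) with J the all-ones matrix.  The minors of order j of
-- ± (k I - J) are (± 1)ʲ kʲ⁻¹ (k - j); conversely, these two matrices
-- realise the two possible sequences.
module Submission where

open import Algebra.Bundles using (CommutativeRing; RawRing; Semiring)
open import Data.Fin.Base as Fin using (Fin; zero; suc; toℕ; punchIn; punchOut; cast) renaming (_<_ to _<ᶠ_)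
import Data.Fin.Properties as Fin
open import Data.Nat.Base as ℕ using (ℕ; zero; suc)
import Data.Nat.Properties as ℕ
open import Data.Product.Base using (∃-syntax; _×_; _,_; proj₁; proj₂)
open import Data.Sum.Base using (_⊎_; inj₁; inj₂)
open import Function.Base using (_∘_)
open import Level using (0ℓ; _⊔_)
open import Relation.Binary.PropositionalEquality as ≡ using (_≡_; _≢_)
open import Relation.Nullary.Decidable using (Dec; yes; no; ¬?; map′)
open import Relation.Nullary.Negation using (¬_; contradiction)
open import Defs using (det; Matrix)

-- The scalar k comes from an inversion: the inverse of 2 I - J of order m is proportional to (m -
-- 2) I - J, and here m = k + 2. Nothing is assumed about the determinant of M; that it is nonzero
-- follows from the same relations on G.
--
-- The scaling w depends on M, so submatrices cannot be compared through it. It is eliminated: what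
-- passes to B are relations between the entries on three indices, and any three indices lie in a
-- common submatrix of order k + 2. A scaling for all of B is then read off from its first row.
--
-- Two features of the Cauchy reals shape the rest. A nonzero number, being merely not zero, is not
-- known to be invertible, so the algebra takes place in a commutative ring with cancellation and
-- denominators stay multiplied out. Nor can a sign be decided; it is reached only under a double
-- negation, which suffices because the terms of σ are discrete data.

module RingSolver {c ℓ} (R : CommutativeRing c ℓ) where
  open CommutativeRing R
  open import Algebra.Properties.Semiring.Mult semiring using (×-homo-+; ×1-homo-*) renaming (_×_ to _×'_)
  open import Algebra.Solver.Ring.AlmostCommutativeRing
    using (_-Raw-AlmostCommutative⟶_; fromCommutativeRing)
  open import Data.Maybe.Base as Maybe using (Maybe)
  open import Relation.Binary.Consequences using (dec⇒weaklyDec)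
  open import Relation.Binary.Reasoning.Setoid setoid
  open import Algebra.Properties.AbelianGroup +-abelianGroup using (⁻¹-∙-comm; ⁻¹-involutive)
  open import Algebra.Properties.Ring ring using (-0#≈0#; -‿distribˡ-*; -‿distribʳ-*)
  open import Algebra.Properties.CommutativeSemigroup +-commutativeSemigroup using (interchange)

  -- The pair (m , n) stands for the integer m − n; it is kept reduced,
  -- because the solver compares normal forms syntactically.
  reduce : ℕ × ℕ → ℕ × ℕ
  reduce (a , b) = a ℕ.∸ b , b ℕ.∸ a

  -- Equality in `R` need not be decidable, so normal forms take their coefficients from a separate
  -- ring, the integers, where it is.
  coefficients : RawRing _ _
  coefficients = record
    { Carrier = ℕ × ℕ
    ; _≈_     = _≡_
    ; _+_     = λ (a , b) (c , d) → reduce (a ℕ.+ c , b ℕ.+ d)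
    ; _*_     = λ (a , b) (c , d) → reduce (a ℕ.* c ℕ.+ b ℕ.* d , a ℕ.* d ℕ.+ b ℕ.* c)
    ; -_      = λ (a , b) → b , a
    ; 0#      = 0 , 0
    ; 1#      = 1 , 0
    }

  ⟦_⟧ : ℕ × ℕ → Carrier
  ⟦ a , b ⟧ = a ×' 1# - b ×' 1#

  ⟦⟧-cong : ∀ a b c d → a ℕ.+ d ≡ c ℕ.+ b → ⟦ a , b ⟧ ≈ ⟦ c , d ⟧
  ⟦⟧-cong a b c d e = begin
    A - B                ≈⟨ +-congˡ (+-identityˡ _) ⟨
    A + (0# - B)         ≈⟨ +-congˡ (+-congʳ (-‿inverseʳ D)) ⟨
    A + ((D - D) - B)    ≈⟨ +-congˡ (+-assoc _ _ _) ⟩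
    A + (D + (- D - B))  ≈⟨ +-assoc _ _ _ ⟨
    (A + D) + (- D - B)  ≈⟨ +-congʳ (trans (sym (×-homo-+ 1# a d))
        (trans (reflexive (≡.cong (_×' 1#) e)) (×-homo-+ 1# c b))) ⟩
    (C + B) + (- D - B)  ≈⟨ interchange _ _ _ _ ⟩
    (C - D) + (B - B)    ≈⟨ +-congˡ (-‿inverseʳ B) ⟩
    (C - D) + 0#         ≈⟨ +-identityʳ _ ⟩
    C - D ∎
    where
    A B C D : Carrier
    A = a ×' 1#
    B = b ×' 1#
    C = c ×' 1#
    D = d ×' 1#

  reduce-correct : ∀ x → ⟦ reduce x ⟧ ≈ ⟦ x ⟧
  reduce-correct (a , b) = ⟦⟧-cong (a ℕ.∸ b) (b ℕ.∸ a) a b (∸-comm a b)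
    where
    ∸-comm : ∀ a b → a ℕ.∸ b ℕ.+ b ≡ a ℕ.+ (b ℕ.∸ a)
    ∸-comm zero    b       = ≡.cong (ℕ._+ b) (ℕ.0∸n≡0 b)
    ∸-comm (suc a) zero    = ≡.refl
    ∸-comm (suc a) (suc b) = ≡.trans (ℕ.+-suc (a ℕ.∸ b) b) (≡.cong suc (∸-comm a b))

  +-homo : ∀ x y → ⟦ RawRing._+_ coefficients x y ⟧ ≈ ⟦ x ⟧ + ⟦ y ⟧
  +-homo (a , b) (c , d) = begin
    ⟦ reduce (a ℕ.+ c , b ℕ.+ d) ⟧
      ≈⟨ reduce-correct (a ℕ.+ c , b ℕ.+ d) ⟩
    (a ℕ.+ c) ×' 1# - (b ℕ.+ d) ×' 1#
      ≈⟨ +-cong (×-homo-+ 1# a c) (-‿cong (×-homo-+ 1# b d)) ⟩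
    (a ×' 1# + c ×' 1#) - (b ×' 1# + d ×' 1#)
      ≈⟨ +-congˡ (⁻¹-∙-comm _ _) ⟨
    (a ×' 1# + c ×' 1#) + (- (b ×' 1#) - d ×' 1#)
      ≈⟨ interchange _ _ _ _ ⟩
    ⟦ a , b ⟧ + ⟦ c , d ⟧ ∎

  *-homo : ∀ x y → ⟦ RawRing._*_ coefficients x y ⟧ ≈ ⟦ x ⟧ * ⟦ y ⟧
  *-homo (a , b) (c , d) = begin
    ⟦ reduce (a ℕ.* c ℕ.+ b ℕ.* d , a ℕ.* d ℕ.+ b ℕ.* c) ⟧
      ≈⟨ reduce-correct (a ℕ.* c ℕ.+ b ℕ.* d , a ℕ.* d ℕ.+ b ℕ.* c) ⟩
    (a ℕ.* c ℕ.+ b ℕ.* d) ×' 1# - (a ℕ.* d ℕ.+ b ℕ.* c) ×' 1#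
      ≈⟨ trans (sym (reduce-correct (a ℕ.* c ℕ.+ b ℕ.* d , a ℕ.* d ℕ.+ b ℕ.* c)))
          (+-homo (a ℕ.* c , a ℕ.* d) (b ℕ.* d , b ℕ.* c)) ⟩
    ((a ℕ.* c) ×' 1# - (a ℕ.* d) ×' 1#) + ((b ℕ.* d) ×' 1# - (b ℕ.* c) ×' 1#)
      ≈⟨ +-cong (+-cong (×1-homo-* a c) (-‿cong (×1-homo-* a d)))
                (+-cong (×1-homo-* b d) (-‿cong (×1-homo-* b c))) ⟩
    (A * C - A * D) + (B * D - B * C)
      ≈⟨ +-cong (+-congˡ (-‿distribʳ-* A D))
           (trans (+-comm _ _) (+-cong (-‿distribˡ-* B C)
             (trans (sym (⁻¹-involutive _)) (trans (-‿cong (-‿distribˡ-* B D)) (-‿distribʳ-* (- B) D))))) ⟩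
    (A * C + A * - D) + (- B * C + - B * - D)
      ≈⟨ +-cong (distribˡ A C (- D)) (distribˡ (- B) C (- D)) ⟨
    A * (C - D) + - B * (C - D)
      ≈⟨ distribʳ (C - D) A (- B) ⟨
    (A - B) * (C - D) ∎
    where
    A B C D : Carrier
    A = a ×' 1#
    B = b ×' 1#
    C = c ×' 1#
    D = d ×' 1#

  -- Agrees with ⟦_⟧, but 0 and 1 are interpreted on the nose, so that
  -- equations mentioning 0# and 1# can be reflected.
  ⟦_⟧′ : ℕ × ℕ → Carrier
  ⟦ 0 , 0 ⟧′ = 0#
  ⟦ 1 , 0 ⟧′ = 1#
  ⟦ x ⟧′     = ⟦ x ⟧

  ⟦⟧′≈⟦⟧ : ∀ x → ⟦ x ⟧′ ≈ ⟦ x ⟧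
  ⟦⟧′≈⟦⟧ (0 , 0)           = sym (-‿inverseʳ 0#)
  ⟦⟧′≈⟦⟧ (1 , 0)           = sym (trans (+-congˡ -0#≈0#) (trans (+-identityʳ _) (+-identityʳ _)))
  ⟦⟧′≈⟦⟧ (0 , suc b)       = refl
  ⟦⟧′≈⟦⟧ (1 , suc b)       = refl
  ⟦⟧′≈⟦⟧ (suc (suc a) , b) = refl

  homomorphism : coefficients -Raw-AlmostCommutative⟶ fromCommutativeRing R
  homomorphism = record
    { ⟦_⟧    = ⟦_⟧′
    ; +-homo = λ x y → trans (⟦⟧′≈⟦⟧ (RawRing._+_ coefficients x y))
        (trans (+-homo x y) (sym (+-cong (⟦⟧′≈⟦⟧ x) (⟦⟧′≈⟦⟧ y))))
    ; *-homo = λ x y → trans (⟦⟧′≈⟦⟧ (RawRing._*_ coefficients x y))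
        (trans (*-homo x y) (sym (*-cong (⟦⟧′≈⟦⟧ x) (⟦⟧′≈⟦⟧ y))))
    ; -‿homo = λ { (a , b) → begin
        ⟦ b , a ⟧′                 ≈⟨ ⟦⟧′≈⟦⟧ (b , a) ⟩
        b ×' 1# - a ×' 1#          ≈⟨ +-comm _ _ ⟩
        - (a ×' 1#) + b ×' 1#      ≈⟨ +-congˡ (⁻¹-involutive _) ⟨
        - (a ×' 1#) - - (b ×' 1#)  ≈⟨ ⁻¹-∙-comm _ _ ⟩
        - ⟦ a , b ⟧                ≈⟨ -‿cong (⟦⟧′≈⟦⟧ (a , b)) ⟨
        - ⟦ a , b ⟧′               ∎ }
    ; 0-homo = refl
    ; 1-homo = refl
    }

  _coeff≟_ : ∀ x y → Maybe (⟦ x ⟧′ ≈ ⟦ y ⟧′)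
  (a , b) coeff≟ (c , d) = Maybe.map
    (λ e → trans (⟦⟧′≈⟦⟧ (a , b)) (trans (⟦⟧-cong a b c d e) (sym (⟦⟧′≈⟦⟧ (c , d)))))
    (dec⇒weaklyDec ℕ._≟_ (a ℕ.+ d) (c ℕ.+ b))

  open import Algebra.Solver.Ring coefficients (fromCommutativeRing R) homomorphism _coeff≟_ public
    using (Polynomial; solve; _:=_; _:+_; _:*_; _:-_; :-_; con)

  :0 :1 : ∀ {n} → Polynomial n
  :0 = con (0 , 0)
  :1 = con (1 , 0)

module RingConditions {ℓ₁ ℓ₂} (R : CommutativeRing ℓ₁ ℓ₂) where

  open CommutativeRing R
  open import Algebra.Properties.Semiring.Mult semiring using () renaming (_×_ to _×′_)

  -- These replace the field axioms: a nonzero factor can be cancelled among Cauchy reals, but is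
  -- not known to have an inverse.
  NoTwoTorsion Cancellative CharacteristicZero : Set _
  NoTwoTorsion       = ∀ x → x ≈ - x → x ≈ 0#
  Cancellative       = ∀ {x y} → ¬ x ≈ 0# → x * y ≈ 0# → y ≈ 0#
  CharacteristicZero = ∀ n → ¬ suc n ×′ 1# ≈ 0#

-- Determinants, cofactors and the determinant of (1 + ρ) I - J

module Determinants {ℓ₁ ℓ₂} (R : CommutativeRing ℓ₁ ℓ₂)
  (x≈-x⇒x≈0 : RingConditions.NoTwoTorsion R) where

  open CommutativeRing R hiding (zero)
  open import Algebra.Properties.Semiring.Sum semiring
  open import Algebra.Properties.Semiring.Exp semiring using (_^_)
  open import Algebra.Properties.Ring ring using (-1*x≈-x; -‿distribˡ-*)
  open import Algebra.Properties.CommutativeSemigroup *-commutativeSemigroup using (x∙yz≈y∙xz)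
  open import Relation.Binary.Reasoning.Setoid setoid
  open RingSolver R

  ∣_∣ : ∀ {n} → Matrix Carrier n → Carrier
  ∣ M ∣ = det rawRing M

  sgn : ∀ {n} → Fin n → Carrier
  sgn i = (- 1#) ^ toℕ i

  sgn-suc : ∀ {n} (i : Fin n) → sgn (suc i) ≈ - sgn i
  sgn-suc i = -1*x≈-x (sgn i)

  sgn*sgn : ∀ {n} (i : Fin n) → sgn i * sgn i ≈ 1#
  sgn*sgn zero    = *-identityˡ 1#
  sgn*sgn (suc i) = trans (*-cong (sgn-suc i) (sgn-suc i))
    (trans (solve 1 (λ x → (:- x) :* (:- x) := x :* x) refl (sgn i)) (sgn*sgn i))

  sgn-cancel : ∀ {n} (i : Fin n) {x} → sgn i * x ≈ 0# → x ≈ 0#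
  sgn-cancel i {x} e = begin
    x                    ≈⟨ *-identityˡ x ⟨
    1# * x               ≈⟨ *-congʳ (sgn*sgn i) ⟨
    sgn i * sgn i * x    ≈⟨ *-assoc _ _ _ ⟩
    sgn i * (sgn i * x)  ≈⟨ *-congˡ e ⟩
    sgn i * 0#           ≈⟨ zeroʳ _ ⟩
    0#                   ∎

  sum-cong : ∀ {n} {f g : Fin n → Carrier} → (∀ i → f i ≈ g i) → sum f ≈ sum g
  sum-cong = sum-cong-≋

  sum-0 : ∀ {n} {f : Fin n → Carrier} → (∀ i → f i ≈ 0#) → sum f ≈ 0#
  sum-0 {n} e = trans (sum-cong e) (sum-replicate-zero n)

  sum-neg : ∀ {n} (f : Fin n → Carrier) → sum (λ i → - f i) ≈ - sum f
  sum-neg f = begin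
    sum (λ i → - f i)       ≈⟨ sum-cong (λ i → sym (-1*x≈-x (f i))) ⟩
    sum (λ i → - 1# * f i)  ≈⟨ *-distribˡ-sum (- 1#) f ⟨
    - 1# * sum f            ≈⟨ -1*x≈-x (sum f) ⟩
    - sum f                 ∎

  delete : ∀ {n} → Matrix Carrier (suc n) → Fin (suc n) → Fin (suc n) → Matrix Carrier n
  delete M i j a b = M (punchIn i a) (punchIn j b)

  det-cong : ∀ {n} (M P : Matrix Carrier n) → (∀ i j → M i j ≈ P i j) → ∣ M ∣ ≈ ∣ P ∣
  det-cong {zero}  M P e = refl
  det-cong {suc n} M P e = sum-cong λ j →
    *-congˡ {x = sgn j} (*-cong (e zero j) (det-cong (delete M zero j) (delete P zero j) λ i k →
        e (suc i) (punchIn j k)))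

  _ᵀ : ∀ {n} → Matrix Carrier n → Matrix Carrier n
  (M ᵀ) i j = M j i

  -- Expand along the first row and then, by induction, each minor beyond the corner along its first
  -- column. The result is a double sum in which rows and columns have symmetric roles; exchanging
  -- the sums gives the column expansion.
  columnExpansion : ∀ {n} (M : Matrix Carrier (suc n)) →
    ∣ M ∣ ≈ sum (λ i → sgn i * (M i zero * ∣ delete M i zero ∣))
  columnExpansion {zero}  M = refl
  columnExpansion {suc n} M = +-congˡ {x = sgn {1} zero * (M zero zero * ∣ delete M zero zero ∣)} (begin
    sum (λ j → sgn (suc j) * (a j * ∣ delete M zero (suc j) ∣))
      ≈⟨ sum-cong (λ j → *-congˡ {x = sgn (suc j)} (*-congˡ {x = a j}
          (columnExpansion (delete M zero (suc j))))) ⟩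
    sum (λ j → sgn (suc j) * (a j * sum (λ i → sgn i * (b i * d i j))))
      ≈⟨ sum-cong (λ j → expand (sgn-suc j) (a j) (λ i → sgn i) b (λ i → d i j)) ⟩
    sum (λ j → sum (λ i → - (sgn j * (a j * (sgn i * (b i * d i j))))))
      ≈⟨ ∑-comm (λ j i → - (sgn j * (a j * (sgn i * (b i * d i j))))) ⟩
    sum (λ i → sum (λ j → - (sgn j * (a j * (sgn i * (b i * d i j))))))
      ≈⟨ sum-cong (λ i → sum-cong (λ j → solve 5 (λ s a t b d →
           :- (s :* (a :* (t :* (b :* d)))) := :- (t :* (b :* (s :* (a :* d))))) refl
           (sgn j) (a j) (sgn i) (b i) (d i j))) ⟩
    sum (λ i → sum (λ j → - (sgn i * (b i * (sgn j * (a j * d i j))))))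
      ≈⟨ sum-cong (λ i → expand (sgn-suc i) (b i) (λ j → sgn j) a (d i)) ⟨
    sum (λ i → sgn (suc i) * (b i * ∣ delete M (suc i) zero ∣)) ∎)
    where
    a b : Fin (suc n) → Carrier
    a j = M zero (suc j)
    b i = M (suc i) zero
    d : Fin (suc n) → Fin (suc n) → Carrier
    d i j = ∣ (λ x y → M (suc (punchIn i x)) (suc (punchIn j y))) ∣
    expand : ∀ {s s′} → s ≈ - s′ → ∀ a (t b d : Fin (suc n) → Carrier) →
      s * (a * sum (λ i → t i * (b i * d i))) ≈ sum (λ i → - (s′ * (a * (t i * (b i * d i)))))
    expand {s} {s′} e a t b d = begin
      s * (a * sum f)                  ≈⟨ *-cong e (*-distribˡ-sum a f) ⟩
      - s′ * sum (λ i → a * f i)       ≈⟨ *-distribˡ-sum (- s′) (λ i → a * f i) ⟩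
      sum (λ i → - s′ * (a * f i))     ≈⟨ sum-cong (λ i → sym (-‿distribˡ-* s′ (a * f i))) ⟩
      sum (λ i → - (s′ * (a * f i)))   ∎
      where
      f : Fin (suc n) → Carrier
      f i = t i * (b i * d i)

  det-ᵀ : ∀ {n} (M : Matrix Carrier n) → ∣ M ᵀ ∣ ≈ ∣ M ∣
  det-ᵀ {zero}  M = refl
  det-ᵀ {suc n} M = trans
    (sum-cong λ j → *-congˡ {x = sgn j} (*-congˡ {x = M j zero} (det-ᵀ (delete M j zero))))
    (sym (columnExpansion M))

  swap₀₁ : ∀ {n} → Fin (2 ℕ.+ n) → Fin (2 ℕ.+ n)
  swap₀₁ zero          = suc zero
  swap₀₁ (suc zero)    = zero
  swap₀₁ (suc (suc i)) = suc (suc i)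

  -- In the expansion along the first row the first two terms trade places, and their signs are
  -- opposite. Each later minor still contains both swapped columns, so induction applies.
  det-swapColumns : ∀ {n} (M : Matrix Carrier (2 ℕ.+ n)) →
    ∣ (λ i j → M i (swap₀₁ j)) ∣ ≈ - ∣ M ∣
  det-swapColumns {n} M = begin
    t * (M zero (suc zero) * D₀) + (u * (M zero zero * D₁) + sum r)
      ≈⟨ +-cong (*-congˡ {x = t} (*-congˡ {x = M zero (suc zero)} e₀))
          (+-cong (*-congˡ {x = u} (*-congˡ {x = M zero zero} e₁))
          (trans (sum-cong (rest n M)) (sum-neg r′))) ⟩
    t * (M zero (suc zero) * C₁) + (u * (M zero zero * C₀) - sum r′)
      ≈⟨ solve 5 (λ a b c d e → :1 :* (a :* b) :+ (((:- :1) :* :1) :* (c :* d) :- e)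
           := :- (:1 :* (c :* d) :+ (((:- :1) :* :1) :* (a :* b) :+ e))) refl _ _ _ _ _ ⟩
    - ∣ M ∣ ∎
    where
    t u D₀ D₁ C₀ C₁ : Carrier
    t = sgn {2} zero
    u = sgn {2} (suc zero)
    D₀ = ∣ (λ i j → M (suc i) (swap₀₁ (suc j))) ∣
    D₁ = ∣ (λ i j → M (suc i) (swap₀₁ (punchIn (suc zero) j))) ∣
    C₀ = ∣ delete M zero zero ∣
    C₁ = ∣ delete M zero (suc zero) ∣
    r r′ : Fin n → Carrier
    r j = sgn (suc (suc j)) * (M zero (suc (suc j)) *
      ∣ (λ i k → M (suc i) (swap₀₁ (punchIn (suc (suc j)) k))) ∣)
    r′ j = sgn (suc (suc j)) * (M zero (suc (suc j)) * ∣ delete M zero (suc (suc j)) ∣)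
    e₀ : D₀ ≈ C₁
    e₀ = det-cong (λ i j → M (suc i) (swap₀₁ (suc j))) (delete M zero (suc zero))
      λ { i zero → refl ; i (suc j) → refl }
    e₁ : D₁ ≈ C₀
    e₁ = det-cong (λ i j → M (suc i) (swap₀₁ (punchIn (suc zero) j))) (delete M zero zero)
      λ { i zero → refl ; i (suc j) → refl }
    rest : ∀ n (M : Matrix Carrier (2 ℕ.+ n)) j →
      sgn (suc (suc j)) * (M zero (suc (suc j)) *
        ∣ (λ i k → M (suc i) (swap₀₁ (punchIn (suc (suc j)) k))) ∣)
      ≈ - (sgn (suc (suc j)) * (M zero (suc (suc j)) * ∣ delete M zero (suc (suc j)) ∣))
    rest (suc n) M j = begin
      s * (m * ∣ (λ i k → M (suc i) (swap₀₁ (punchIn (suc (suc j)) k))) ∣)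
        ≈⟨ *-congˡ {x = s} (*-congˡ {x = m} (det-cong
            (λ i k → M (suc i) (swap₀₁ (punchIn (suc (suc j)) k)))
            (λ i k → delete M zero (suc (suc j)) i (swap₀₁ k))
            λ { i zero → refl ; i (suc zero) → refl ; i (suc (suc k)) → refl })) ⟩
      s * (m * ∣ (λ i k → delete M zero (suc (suc j)) i (swap₀₁ k)) ∣)
        ≈⟨ *-congˡ {x = s} (*-congˡ {x = m} (det-swapColumns (delete M zero (suc (suc j))))) ⟩
      s * (m * - ∣ delete M zero (suc (suc j)) ∣)
        ≈⟨ solve 3 (λ s m d → s :* (m :* (:- d)) := :- (s :* (m :* d))) refl s m _ ⟩
      - (s * (m * ∣ delete M zero (suc (suc j)) ∣)) ∎
      where
      s m : Carrier
      s = sgn (suc (suc j))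
      m = M zero (suc (suc j))

  det-swapRows : ∀ {n} (M : Matrix Carrier (2 ℕ.+ n)) →
    ∣ (λ i j → M (swap₀₁ i) j) ∣ ≈ - ∣ M ∣
  det-swapRows M = begin
    ∣ (λ i j → M (swap₀₁ i) j) ∣          ≈⟨ det-ᵀ (λ i j → M (swap₀₁ i) j) ⟨
    ∣ (λ i j → (M ᵀ) i (swap₀₁ j)) ∣      ≈⟨ det-swapColumns (M ᵀ) ⟩
    - ∣ M ᵀ ∣                             ≈⟨ -‿cong (det-ᵀ M) ⟩
    - ∣ M ∣                               ∎

  lift : ∀ {m n} → (Fin m → Fin n) → Fin (suc m) → Fin (suc n)
  lift f zero    = zero
  lift f (suc i) = suc (f i)

  det-lift : ∀ {n} {f : Fin n → Fin n} {s} →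
    (∀ P → ∣ (λ i j → P (f i) j) ∣ ≈ s * ∣ P ∣) →
    ∀ M → ∣ (λ i j → M (lift f i) j) ∣ ≈ s * ∣ M ∣
  det-lift {s = s} e M = trans
    (sum-cong λ j → trans (*-congˡ {x = sgn j} (*-congˡ {x = M zero j} (e (delete M zero j))))
      (solve 4 (λ t m s d → t :* (m :* (s :* d)) := s :* (t :* (m :* d)))
          refl (sgn j) (M zero j) s ∣ delete M zero j ∣))
    (sym (*-distribˡ-sum s (λ j → sgn j * (M zero j * ∣ delete M zero j ∣))))

  moveFront : ∀ {n} → Fin (suc n) → Fin (suc n) → Fin (suc n)
  moveFront c zero    = c
  moveFront c (suc i) = punchIn c i

  -- Row `c` reaches the front by `c` adjacent transpositions: induction brings it to the second
  -- place, and one more swap finishes.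
  det-moveFront : ∀ {n} c (M : Matrix Carrier (suc n)) →
    ∣ (λ i j → M (moveFront c i) j) ∣ ≈ sgn c * ∣ M ∣
  det-moveFront zero M = trans
    (det-cong (λ i j → M (moveFront zero i) j) M λ { zero j → refl ; (suc i) j → refl })
    (sym (*-identityˡ ∣ M ∣))
  det-moveFront {suc n} (suc c) M = begin
    ∣ (λ i j → M (moveFront (suc c) i) j) ∣
      ≈⟨ det-cong (λ i j → M (moveFront (suc c) i) j) (λ i j → M (lift (moveFront c) (swap₀₁ i)) j)
          (λ { zero j → refl ; (suc zero) j → refl ; (suc (suc i)) j → refl }) ⟩
    ∣ (λ i j → M (lift (moveFront c) (swap₀₁ i)) j) ∣
      ≈⟨ det-swapRows (λ i j → M (lift (moveFront c) i) j) ⟩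
    - ∣ (λ i j → M (lift (moveFront c) i) j) ∣
      ≈⟨ -‿cong (det-lift {f = moveFront c} (det-moveFront c) M) ⟩
    - (sgn c * ∣ M ∣)
      ≈⟨ trans (-‿distribˡ-* (sgn c) ∣ M ∣) (*-congʳ (sym (sgn-suc c))) ⟩
    sgn (suc c) * ∣ M ∣ ∎

  -- Bring the equal row next to the first one. Swapping the two fixes the matrix and negates its
  -- determinant, which is therefore its own negative.
  det-equalRows : ∀ {n} a (M : Matrix Carrier (2 ℕ.+ n)) →
    (∀ j → M zero j ≈ M (suc a) j) → ∣ M ∣ ≈ 0#
  det-equalRows {n} a M e = sgn-cancel a (trans
    (sym (det-lift {f = moveFront a} (det-moveFront a) M))
    (x≈-x⇒x≈0 _ (trans (det-cong M′ (λ i j → M′ (swap₀₁ i) j) same) (det-swapRows M′))))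
    where
    M′ : Matrix Carrier (2 ℕ.+ n)
    M′ i j = M (lift (moveFront a) i) j
    same : ∀ i j → M′ i j ≈ M′ (swap₀₁ i) j
    same zero          j = e j
    same (suc zero)    j = sym (e j)
    same (suc (suc i)) j = refl

  -- An entry of the transposed adjugate. Two separate signs stand for the sign of c + j, so that
  -- `sgn*sgn` can clear them.
  cof : ∀ {n} → Matrix Carrier (suc n) → Fin (suc n) → Fin (suc n) → Carrier
  cof M c j = sgn c * (sgn j * ∣ delete M c j ∣)

  cof-diagonal : ∀ {n} (M : Matrix Carrier (suc n)) c → cof M c c ≈ ∣ delete M c c ∣
  cof-diagonal M c = trans (sym (*-assoc _ _ _)) (trans (*-congʳ (sgn*sgn c)) (*-identityˡ _))

  laplace : ∀ {n} (M : Matrix Carrier (suc n)) c → sum (λ j → M c j * cof M c j) ≈ ∣ M ∣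
  laplace M c = begin
    sum (λ j → M c j * cof M c j)
      ≈⟨ sum-cong (λ j → solve 4 (λ m s t d → m :* (s :* (t :* d)) := s :* (t :* (m :* d))) refl
           (M c j) (sgn c) (sgn j) ∣ delete M c j ∣) ⟩
    sum (λ j → sgn c * (sgn j * (M c j * ∣ delete M c j ∣)))
      ≈⟨ *-distribˡ-sum (sgn c) (λ j → sgn j * (M c j * ∣ delete M c j ∣)) ⟨
    sgn c * ∣ (λ i j → M (moveFront c i) j) ∣
      ≈⟨ *-congˡ (det-moveFront c M) ⟩
    sgn c * (sgn c * ∣ M ∣)
      ≈⟨ trans (sym (*-assoc _ _ _)) (trans (*-congʳ (sgn*sgn c)) (*-identityˡ _)) ⟩
    ∣ M ∣ ∎

  -- Up to sign, the sum expands the matrix in which row `c` is replaced by a second copy of row `i`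
  -- and moved to the front.
  laplace-alien : ∀ {n} (M : Matrix Carrier (suc n)) {i c} → i ≢ c →
    sum (λ j → M i j * cof M c j) ≈ 0#
  laplace-alien {zero} M {zero} {zero} i≢c with () ← i≢c ≡.refl
  laplace-alien {suc n} M {i} {c} i≢c = begin
    sum (λ j → M i j * cof M c j)
      ≈⟨ sum-cong (λ j → solve 4 (λ m s t d → m :* (s :* (t :* d)) := s :* (t :* (m :* d))) refl
           (M i j) (sgn c) (sgn j) ∣ delete M c j ∣) ⟩
    sum (λ j → sgn c * (sgn j * (M i j * ∣ delete M c j ∣)))
      ≈⟨ *-distribˡ-sum (sgn c) (λ j → sgn j * (M i j * ∣ delete M c j ∣)) ⟨
    sgn c * ∣ M′ ∣
      ≈⟨ *-congˡ (det-equalRows (punchOut (i≢c ∘ ≡.sym)) M′ λ j →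
           reflexive (≡.cong (λ i → M i j) (≡.sym (Fin.punchIn-punchOut (i≢c ∘ ≡.sym))))) ⟩
    sgn c * 0#
      ≈⟨ zeroʳ _ ⟩
    0# ∎
    where
    M′ : Matrix Carrier (2 ℕ.+ n)
    M′ zero    j = M i j
    M′ (suc a) j = M (punchIn c a) j

  sum-single : ∀ {n} (f : Fin n → Carrier) c → (∀ i → i ≢ c → f i ≈ 0#) → sum f ≈ f c
  sum-single {suc n} f c e = begin
    sum f                            ≈⟨ sum-remove f ⟩
    f c + sum (λ i → f (punchIn c i))  ≈⟨ +-congˡ (sum-0 λ i → e _ (Fin.punchInᵢ≢i c i)) ⟩
    f c + 0#                         ≈⟨ +-identityʳ _ ⟩
    f c                              ∎

  -- Multiply the relation u M = 0 on the right by the adjugate, which turns `M` into the scalar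
  -- `∣ M ∣`; nothing is divided.
  kernel-det : ∀ {n} (M : Matrix Carrier n) (u : Fin n → Carrier) →
    (∀ j → sum (λ i → u i * M i j) ≈ 0#) → ∀ c → ∣ M ∣ * u c ≈ 0#
  kernel-det {suc n} M u e c = begin
    ∣ M ∣ * u c
      ≈⟨ trans (*-comm _ _) (*-congˡ (sym (laplace M c))) ⟩
    u c * sum (λ j → M c j * cof M c j)
      ≈⟨ sum-single (λ i → u i * sum (λ j → M i j * cof M c j)) c
          (λ i i≢c → trans (*-congˡ (laplace-alien M i≢c)) (zeroʳ _)) ⟨
    sum (λ i → u i * sum (λ j → M i j * cof M c j))
      ≈⟨ sum-cong (λ i → trans (*-distribˡ-sum (u i) (λ j → M i j * cof M c j))
          (sum-cong λ j → sym (*-assoc (u i) (M i j) (cof M c j)))) ⟩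
    sum (λ i → sum (λ j → u i * M i j * cof M c j))
      ≈⟨ ∑-comm (λ i j → u i * M i j * cof M c j) ⟩
    sum (λ j → sum (λ i → u i * M i j * cof M c j))
      ≈⟨ sum-0 (λ j → trans (sym (*-distribʳ-sum (cof M c j) (λ i → u i * M i j)))
          (trans (*-congʳ (e j)) (zeroˡ _))) ⟩
    0# ∎

  cof-sym : ∀ {n} {M : Matrix Carrier (suc n)} → (∀ i j → M i j ≈ M j i) → ∀ i j → cof M i j ≈ cof M j i
  cof-sym {M = M} M-sym i j = begin
    sgn i * (sgn j * ∣ delete M i j ∣)
      ≈⟨ x∙yz≈y∙xz (sgn i) (sgn j) _ ⟩
    sgn j * (sgn i * ∣ delete M i j ∣)
      ≈⟨ *-congˡ (*-congˡ (trans (sym (det-ᵀ (delete M i j)))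
          (det-cong (delete M i j ᵀ) (delete M j i) λ a b → M-sym _ _))) ⟩
    sgn j * (sgn i * ∣ delete M j i ∣) ∎

  open import Algebra.Definitions.RawSemiring (Semiring.rawSemiring semiring) using (product)

  det-scaleRows : ∀ {n} (a : Fin n → Carrier) (M : Matrix Carrier n) →
    ∣ (λ i j → a i * M i j) ∣ ≈ product a * ∣ M ∣
  det-scaleRows {zero}  a M = sym (*-identityˡ 1#)
  det-scaleRows {suc n} a M = trans
    (sum-cong λ j → trans
      (*-congˡ {x = sgn j} (*-congˡ {x = a zero * M zero j} (det-scaleRows (a ∘ suc) (delete M zero j))))
      (solve 5 (λ s a m p d → s :* ((a :* m) :* (p :* d)) := (a :* p) :* (s :* (m :* d))) refl
        (sgn j) (a zero) (M zero j) (product (a ∘ suc)) ∣ delete M zero j ∣))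
    (sym (*-distribˡ-sum (product a) (λ j → sgn j * (M zero j * ∣ delete M zero j ∣))))

  product-const : ∀ n x → product {n} (λ _ → x) ≈ x ^ n
  product-const zero    x = refl
  product-const (suc n) x = *-congˡ (product-const n x)

  -- `x` is a common denominator: `M` is P with rows scaled by `a`, columns by `b`, and everything
  -- divided by `x`.
  det-rescale : ∀ {n} x (a b : Fin n → Carrier) (M P : Matrix Carrier n) →
    (∀ i j → x * M i j ≈ a i * (b j * P i j)) →
    x ^ n * ∣ M ∣ ≈ product a * (product b * ∣ P ∣)
  det-rescale {n} x a b M P e = begin
    x ^ n * ∣ M ∣
      ≈⟨ *-congʳ (product-const n x) ⟨
    product {n} (λ _ → x) * ∣ M ∣
      ≈⟨ det-scaleRows (λ _ → x) M ⟨
    ∣ (λ i j → x * M i j) ∣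
      ≈⟨ det-cong (λ i j → x * M i j) (λ i j → a i * (b j * P i j)) e ⟩
    ∣ (λ i j → a i * (b j * P i j)) ∣
      ≈⟨ det-scaleRows a (λ i j → b j * P i j) ⟩
    product a * ∣ (λ i j → b j * P i j) ∣
      ≈⟨ *-congˡ (trans (sym (det-ᵀ (λ i j → b j * P i j)))
          (trans (det-scaleRows b (P ᵀ)) (*-congˡ (det-ᵀ P)))) ⟩
    product a * (product b * ∣ P ∣) ∎

  open import Algebra.Properties.Semiring.Mult semiring using () renaming (_×_ to _×′_)

  κ : ℕ → Carrier
  κ n = n ×′ 1#

  module DiagonalMinusOnes (ρ : Carrier) where

    -- (1 + ρ) I - J, where J is the all-ones matrix.
    K : ∀ {n} → Matrix Carrier n
    K zero    zero    = ρ
    K zero    (suc j) = - 1#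
    K (suc i) zero    = - 1#
    K (suc i) (suc j) = K i j

    K-diagonal : ∀ {n} (i : Fin n) → K i i ≡ ρ
    K-diagonal zero    = ≡.refl
    K-diagonal (suc i) = K-diagonal i

    K-off : ∀ {n} {i j : Fin n} → i ≢ j → K i j ≡ - 1#
    K-off {i = zero}  {zero}  i≢j with () ← i≢j ≡.refl
    K-off {i = zero}  {suc j} i≢j = ≡.refl
    K-off {i = suc i} {zero}  i≢j = ≡.refl
    K-off {i = suc i} {suc j} i≢j = K-off (i≢j ∘ ≡.cong suc)

    -- An entry of `K` depends only on whether its two indices agree, so every principal submatrix
    -- of `K` is again a `K`.
    K-injective : ∀ {m n} (f : Fin m → Fin n) → (∀ {i j} → f i ≡ f j → i ≡ j) → ∀ i j →
        K (f i) (f j) ≡ K i j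
    K-injective f f-inj i j with i Fin.≟ j
    ... | yes ≡.refl = ≡.trans (K-diagonal (f i)) (≡.sym (K-diagonal i))
    ... | no i≢j     = ≡.trans (K-off (i≢j ∘ f-inj)) (≡.sym (K-off i≢j))

    -- Deleting the first row and the second column of `K` leaves this shape, and so does the same
    -- deletion from `K₁`, which closes the recursion below.
    K₁ : ∀ {n} → Matrix Carrier (suc n)
    K₁ zero    j = - 1#
    K₁ (suc i) j = K (suc i) j

    -- The second row shows that the cofactors along the first row sum to
    -- 1 + ρ times the second of them, which is again of the form ∣ K₁ ∣.
    det-K₁ : ∀ n → ∣ K₁ {n} ∣ ≈ - (1# + ρ) ^ n
    det-K₁ zero    = solve 0 (:1 :* ((:- :1) :* :1) :+ :0 := :- :1) refl
    det-K₁ (suc n) = begin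
      ∣ M ∣
        ≈⟨ laplace M zero ⟨
      sum (λ j → - 1# * c j)
        ≈⟨ *-distribˡ-sum (- 1#) c ⟨
      - 1# * sum c
        ≈⟨ *-congˡ (sum-remove {i = suc zero} c) ⟩
      - 1# * (c (suc zero) + rest)
        ≈⟨ solve 3 (λ c r ρ → (:- :1) :* (c :+ r) := (ρ :* c :+ (:- :1) :* r) :- (:1 :+ ρ) :* c)
            refl (c (suc zero)) rest ρ ⟩
      (ρ * c (suc zero) + - 1# * rest) - (1# + ρ) * c (suc zero)
        ≈⟨ +-cong
             (trans (+-congˡ (*-distribˡ-sum (- 1#) (λ j → c (punchIn (suc zero) j))))
               (trans (sym (trans (sum-remove {i = suc zero} (λ j → M (suc zero) j * c j))
                   (+-congˡ (sum-cong λ j → *-congʳ {x = c (punchIn (suc zero) j)}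
                       (reflexive (K-off (Fin.punchInᵢ≢i (suc zero) j ∘ ≡.sym)))))))
                 (laplace-alien M {suc zero} {zero} (λ ()))))
             (-‿cong (*-congˡ (*-congˡ (*-congˡ (trans (det-cong (delete M zero (suc zero)) K₁ same)
                 (det-K₁ n)))))) ⟩
      0# - (1# + ρ) * (1# * ((- 1# * 1#) * - (1# + ρ) ^ n))
        ≈⟨ solve 2 (λ k p → :0 :- k :* (:1 :* (((:- :1) :* :1) :* (:- p))) := :- (k :* p))
            refl (1# + ρ) ((1# + ρ) ^ n) ⟩
      - (1# + ρ) ^ suc n ∎
      where
      M : Matrix Carrier (2 ℕ.+ n)
      M = K₁
      c : Fin (2 ℕ.+ n) → Carrier
      c = cof M zero
      rest : Carrier
      rest = sum (λ j → c (punchIn (suc zero) j))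
      same : ∀ i j → delete M zero (suc zero) i j ≈ K₁ i j
      same zero    zero    = refl
      same zero    (suc j) = refl
      same (suc i) zero    = refl
      same (suc i) (suc j) = refl

    -- `K` and `K₁` differ only in the corner entry, ρ against -1, so their determinants differ by 1
    -- + ρ times the minor of that entry.
    det-K-suc : ∀ n → ∣ K {suc n} ∣ ≈ (1# + ρ) * ∣ K {n} ∣ - (1# + ρ) ^ n
    det-K-suc n = trans
      (solve 3 (λ ρ d t → :1 :* (ρ :* d) :+ t := (:1 :+ ρ) :* d :+ (:1 :* ((:- :1) :* d) :+ t)) refl
        ρ ∣ K {n} ∣ (sum (λ j → sgn (suc j) * (- 1# * ∣ delete (K {suc n}) zero (suc j) ∣))))
      (+-congˡ (det-K₁ n))

    det-K : ∀ n → ∣ K {suc n} ∣ ≈ (1# + ρ) ^ n * (ρ - κ n)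
    det-K zero    = trans (det-K-suc zero) (solve 1 (λ ρ → (:1 :+ ρ) :* :1 :- :1 := :1 :* (ρ :- :0)) refl ρ)
    det-K (suc n) = trans (det-K-suc (suc n)) (trans
      (+-congʳ (*-congˡ (det-K n)))
      (solve 4 (λ k p ρ c → k :* (p :* (ρ :- c)) :- k :* p := k :* p :* (ρ :- (:1 :+ c))) refl
        (1# + ρ) ((1# + ρ) ^ n) ρ (κ n)))

  product-neg : ∀ {n} (a : Fin n → Carrier) → product (λ i → - a i) ≈ (- 1#) ^ n * product a
  product-neg {zero}  a = sym (*-identityˡ 1#)
  product-neg {suc n} a = trans (*-congˡ (product-neg (a ∘ suc)))
    (solve 3 (λ x s p → (:- x) :* (s :* p) := ((:- :1) :* s) :* (x :* p))
        refl (a zero) ((- 1#) ^ n) (product (a ∘ suc)))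

  -- The scaling enters through a square, so it will not affect the signs of minors.
  det-congruence⁺ : ∀ {n} x (a : Fin n → Carrier) (M P : Matrix Carrier n) →
    (∀ i j → x * M i j ≈ a i * (a j * P i j)) →
    x ^ n * ∣ M ∣ ≈ product a * product a * ∣ P ∣
  det-congruence⁺ x a M P e = trans (det-rescale x a a M P e) (sym (*-assoc _ _ _))

  det-congruence⁻ : ∀ {n} x (a : Fin n → Carrier) (M P : Matrix Carrier n) →
    (∀ i j → x * M i j ≈ - a i * (a j * P i j)) →
    x ^ n * ∣ M ∣ ≈ (- 1#) ^ n * (product a * product a * ∣ P ∣)
  det-congruence⁻ {n} x a M P e = trans (det-rescale x (λ i → - a i) a M P e)
    (trans (*-congʳ (product-neg a))
      (solve 3 (λ s p d → s :* p :* (p :* d) := s :* (p :* p :* d)) refl ((- 1#) ^ n) (product a) ∣ P ∣))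

  κ-suc-minus : ∀ m n → κ (suc m) - κ (suc n) ≈ κ m - κ n
  κ-suc-minus m n = solve 2 (λ x y → (:1 :+ x) :- (:1 :+ y) := x :- y) refl (κ m) (κ n)

-- Rigidity of symmetric matrices over a cancellative ring of characteristic zero

module CharZeroDomain {c ℓ} (R : CommutativeRing c ℓ)
  (cancel : RingConditions.Cancellative R) (char-0 : RingConditions.CharacteristicZero R) where

  open CommutativeRing R hiding (zero)
  open import Data.Vec.Functional using (insertAt)
  open import Data.Vec.Functional.Properties using (insertAt-lookup; insertAt-punchIn)
  open import Algebra.Properties.Ring ring using (x∙y⁻¹≈ε⇒x≈y; x≈y⇒x∙y⁻¹≈ε; -‿involutive; -0#≈0#)
  open import Relation.Binary.Reasoning.Setoid setoid
  open import Algebra.Properties.Semiring.Sum semiring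
  open RingSolver R

  2# : Carrier
  2# = 1# + 1#

  2≉0 : ¬ 2# ≈ 0#
  2≉0 e = char-0 1 (trans (+-congˡ (+-identityʳ 1#)) e)

  x≈-x⇒x≈0 : ∀ x → x ≈ - x → x ≈ 0#
  x≈-x⇒x≈0 x e = cancel 2≉0 (begin
    2# * x    ≈⟨ solve 1 (λ x → (:1 :+ :1) :* x := x :+ x) refl x ⟩
    x + x     ≈⟨ +-congˡ e ⟩
    x + - x   ≈⟨ -‿inverseʳ x ⟩
    0#        ∎)

  open Determinants R x≈-x⇒x≈0 public

  ≉0-* : ∀ {x y} → ¬ x ≈ 0# → ¬ y ≈ 0# → ¬ x * y ≈ 0#
  ≉0-* x≉0 y≉0 xy≈0 = y≉0 (cancel x≉0 xy≈0)

  ≉0-neg : ∀ {x} → ¬ x ≈ 0# → ¬ - x ≈ 0#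
  ≉0-neg x≉0 e = x≉0 (trans (sym (-‿involutive _)) (trans (-‿cong e) -0#≈0#))

  cancel-≈ : ∀ {x y z} → ¬ x ≈ 0# → x * y ≈ x * z → y ≈ z
  cancel-≈ {x} {y} {z} x≉0 e = x∙y⁻¹≈ε⇒x≈y y z (cancel x≉0 (begin
    x * (y - z)    ≈⟨ solve 3 (λ x y z → x :* (y :- z) := x :* y :- x :* z) refl x y z ⟩
    x * y - x * z  ≈⟨ x≈y⇒x∙y⁻¹≈ε e ⟩
    0#             ∎))

  IsSymmetric : ∀ {n} → Matrix Carrier n → Set ℓ
  IsSymmetric M = ∀ i j → M i j ≈ M j i

  infixr 8 _·_
  _·_ : ∀ {n} → Matrix Carrier n → (Fin n → Carrier) → Fin n → Carrier
  (M · u) i = sum λ j → M i j * u j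

  nonsingular : ∀ {n} {M : Matrix Carrier n} → IsSymmetric M → ¬ ∣ M ∣ ≈ 0# →
    ∀ u → (∀ i → (M · u) i ≈ 0#) → ∀ i → u i ≈ 0#
  nonsingular {M = M} M-sym ∣M∣≉0 u e i = cancel ∣M∣≉0 (kernel-det M u
    (λ j → trans (sum-cong λ i → trans (*-congˡ (M-sym i j)) (*-comm (u i) (M j i))) (e j)) i)

  pairing : ∀ {n} {M : Matrix Carrier n} → IsSymmetric M → ∀ u v →
    sum (λ i → (M · u) i * v i) ≈ sum (λ i → u i * (M · v) i)
  pairing {n} {M} M-sym u v = begin
    sum (λ i → (M · u) i * v i)
      ≈⟨ sum-cong (λ i → *-distribʳ-sum (v i) (λ j → M i j * u j)) ⟩
    sum (λ i → sum (λ j → M i j * u j * v i))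
      ≈⟨ ∑-comm (λ i j → M i j * u j * v i) ⟩
    sum (λ j → sum (λ i → M i j * u j * v i))
      ≈⟨ sum-cong (λ j → sum-cong (λ i → trans
           (solve 3 (λ m a b → m :* a :* b := a :* (m :* b)) refl (M i j) (u j) (v i))
           (*-congˡ (*-congʳ (M-sym i j))))) ⟩
    sum (λ j → sum (λ i → u j * (M j i * v i)))
      ≈⟨ sum-cong (λ j → *-distribˡ-sum (u j) (λ i → M j i * v i)) ⟨
    sum (λ j → u j * (M · v) j) ∎

  sum-drop : ∀ {n} (f : Fin (suc n) → Carrier) c → f c ≈ 0# → sum f ≈ sum (f ∘ punchIn c)
  sum-drop f c e = trans (sum-remove f) (trans (+-congʳ e) (+-identityˡ _))

  sum-pair : ∀ {n} (f : Fin n → Carrier) {i j} → i ≢ j →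
    (∀ l → l ≢ i → l ≢ j → f l ≈ 0#) → sum f ≈ f i + f j
  sum-pair {suc n} f {i} {j} i≢j e = trans (sum-remove f) (+-congˡ (trans
    (sum-single (f ∘ punchIn i) (punchOut i≢j) λ l l≢ →
      e _ (Fin.punchInᵢ≢i i l) λ eq → l≢ (Fin.punchIn-injective i _ _
        (≡.trans eq (≡.sym (Fin.punchIn-punchOut i≢j)))))
    (reflexive (≡.cong f (Fin.punchIn-punchOut i≢j)))))

  punchIn-surjective : ∀ {n} {i j : Fin (suc n)} → j ≢ i → ∃[ k ] punchIn i k ≡ j
  punchIn-surjective j≢i = punchOut (j≢i ∘ ≡.sym) , Fin.punchIn-punchOut (j≢i ∘ ≡.sym)

  -- Here r = k - 1: `M` has order k + 2, and the hypotheses concern its principal minors of orders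
  -- k + 1, k and k - 1 in turn.
  module Bordered {r} (M : Matrix Carrier (3 ℕ.+ r)) (M-sym : IsSymmetric M)
    (h₁ : ∀ i → ¬ ∣ delete M i i ∣ ≈ 0#)
    (h₂ : ∀ i j → ∣ delete (delete M i i) j j ∣ ≈ 0#)
    (h₃ : ∀ i j l → ¬ ∣ delete (delete (delete M i i) j j) l l ∣ ≈ 0#) where

    G : Matrix Carrier (3 ℕ.+ r)
    G = cof M

    D : Carrier
    D = ∣ M ∣

    G-sym : ∀ i j → G i j ≈ G j i
    G-sym = cof-sym {M = M} M-sym

    Gᵢᵢ≉0 : ∀ i → ¬ G i i ≈ 0#
    Gᵢᵢ≉0 i e = h₁ i (trans (sym (cof-diagonal M i)) e)

    -- The zero `uⱼ` comes from a vanishing minor of order k, and `uₗ` from the nonzero minors of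
    -- orders k - 1 and k + 1.
    record Edge (i j : Fin (3 ℕ.+ r)) : Set (c ⊔ ℓ) where
      field
        u     : Fin (3 ℕ.+ r) → Carrier
        uᵢ    : u i ≈ 0#
        uⱼ    : u j ≈ 0#
        uₗ    : ∀ l → l ≢ i → l ≢ j → ¬ u l ≈ 0#
        Mu-rest : ∀ l → l ≢ i → l ≢ j → (M · u) l ≈ 0#
        Mu-j  : (M · u) j ≈ G i i
        Mu-i  : (M · u) i ≈ - G i j

      dot-Mu : i ≢ j → ∀ (v : Fin (3 ℕ.+ r) → Carrier) → sum (λ a → (M · u) a * v a) ≈
        - G i j * v i + G i i * v j
      dot-Mu i≢j v = trans
        (sum-pair (λ a → (M · u) a * v a) i≢j λ l l≢i l≢j →
            trans (*-congʳ {x = v l} (Mu-rest l l≢i l≢j)) (zeroˡ (v l)))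
        (+-cong (*-congʳ {x = v i} Mu-i) (*-congʳ {x = v j} Mu-j))

    dot-MG : ∀ l (u : Fin (3 ℕ.+ r) → Carrier) → sum (λ a → u a * (M · G l) a) ≈ u l * D
    dot-MG l u = trans
      (sum-single (λ a → u a * (M · G l) a) l λ a a≢l → trans (*-congˡ {x = u a} (laplace-alien M a≢l))
          (zeroʳ (u a)))
      (*-congˡ {x = u l} (laplace M l))

    -- The cofactors of the row j of M with the index i removed.
    edge : ∀ {i j} → i ≢ j → Edge i j
    edge {i} {j} i≢j with punchIn-surjective (i≢j ∘ ≡.sym)
    ... | j′ , ≡.refl = record
      { u = u
      ; uᵢ = uᵢ
      ; uⱼ = trans (u-punchIn j′) v-j′
      ; uₗ = uₗ
      ; Mu-rest = rest
      ; Mu-j = Mu-j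
      -- Pair `M · u` with row `i` of `G`. By symmetry the result is `u i * D`, which is zero, while
      -- only the entries `i` and `j` of `M · u` contribute; cancelling `G i i` determines the entry
      -- at `i`.
      ; Mu-i = x∙y⁻¹≈ε⇒x≈y _ _ (cancel (Gᵢᵢ≉0 i) (begin
          G i i * ((M · u) i - - G i j)
            ≈⟨ solve 3 (λ g m h → g :* (m :- (:- h)) := m :* g :+ g :* h) refl (G i i) ((M · u) i) (G i j) ⟩
          (M · u) i * G i i + G i i * G i j
            ≈⟨ +-congˡ (*-congʳ {x = G i j} Mu-j) ⟨
          (M · u) i * G i i + (M · u) j * G i j
            ≈⟨ sum-pair (λ a → (M · u) a * G i a) i≢j (λ l l≢i l≢j →
                trans (*-congʳ {x = G i l} (rest l l≢i l≢j)) (zeroˡ (G i l))) ⟨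
          sum (λ a → (M · u) a * G i a)
            ≈⟨ pairing {M = M} M-sym u (G i) ⟩
          sum (λ a → u a * (M · G i) a)
            ≈⟨ dot-MG i u ⟩
          u i * D
            ≈⟨ trans (*-congʳ uᵢ) (zeroˡ D) ⟩
          0# ∎))
      }
      where
      P : Matrix Carrier (2 ℕ.+ r)
      P = delete M i i
      v : Fin (2 ℕ.+ r) → Carrier
      v = cof P j′
      u : Fin (3 ℕ.+ r) → Carrier
      u = insertAt v i 0#
      uᵢ : u i ≈ 0#
      uᵢ = reflexive (insertAt-lookup v i 0#)
      u-punchIn : ∀ k → u (punchIn i k) ≈ v k
      u-punchIn k = reflexive (insertAt-punchIn v i 0# k)
      v-j′ : v j′ ≈ 0#
      v-j′ = trans (cof-diagonal P j′) (h₂ i j′)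
      M·u : ∀ a → (M · u) (punchIn i a) ≈ (P · v) a
      M·u a = trans
        (sum-drop (λ l → M (punchIn i a) l * u l) i (trans (*-congˡ uᵢ) (zeroʳ _)))
        (sum-cong λ k → *-congˡ {x = M (punchIn i a) (punchIn i k)} (u-punchIn k))
      Mu-j : (M · u) (punchIn i j′) ≈ G i i
      Mu-j = trans (M·u j′) (trans (laplace P j′) (sym (cof-diagonal M i)))
      rest : ∀ l → l ≢ i → l ≢ punchIn i j′ → (M · u) l ≈ 0#
      rest l l≢i l≢j with punchIn-surjective l≢i
      ... | l′ , ≡.refl = trans (M·u l′) (laplace-alien P (l≢j ∘ ≡.cong (punchIn i)))
      -- If a second entry of `v` is zero, the rest of `v` lies in the kernel of `Q`, a principal
      -- submatrix of order k - 1 with nonzero determinant, so all of `v` is zero.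
      vanish : ∀ l′ → l′ ≢ j′ → v l′ ≈ 0# → ∀ c → v c ≈ 0#
      vanish l′ l′≢j′ v-l′ with punchIn-surjective l′≢j′
      ... | l″ , ≡.refl = case-c
        where
        x : Fin r → Carrier
        x k = v (punchIn j′ (punchIn l″ k))
        Q : Matrix Carrier r
        Q = delete (delete P j′ j′) l″ l″
        Qx : ∀ a → (Q · x) a ≈ 0#
        Qx a = begin
          (Q · x) a
            ≈⟨ sum-drop (λ k → P b (punchIn j′ k) * v (punchIn j′ k)) l″ (trans (*-congˡ v-l′) (zeroʳ _)) ⟨
          sum (λ k → P b (punchIn j′ k) * v (punchIn j′ k))
            ≈⟨ sum-drop (λ k → P b k * v k) j′ (trans (*-congˡ v-j′) (zeroʳ _)) ⟨
          (P · v) b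
            ≈⟨ laplace-alien P (Fin.punchInᵢ≢i j′ _) ⟩
          0# ∎
          where
          b : Fin (2 ℕ.+ r)
          b = punchIn j′ (punchIn l″ a)
        x≈0 : ∀ k → x k ≈ 0#
        x≈0 = nonsingular {M = Q} (λ a b → M-sym _ _) (h₃ i j′ l″) x Qx
        case-c : ∀ c → v c ≈ 0#
        case-c c with c Fin.≟ j′
        ... | yes ≡.refl = v-j′
        ... | no c≢j′ with punchIn-surjective c≢j′
        ... | c′ , ≡.refl with c′ Fin.≟ l″
        ... | yes ≡.refl = v-l′
        ... | no c′≢l″ with punchIn-surjective c′≢l″
        ... | k , ≡.refl = x≈0 k
      -- But `v` cannot be zero: its pairing with row `j′` of `P` is the nonzero minor `∣ P ∣`.
      uₗ : ∀ l → l ≢ i → l ≢ punchIn i j′ → ¬ u l ≈ 0#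
      uₗ l l≢i l≢j uₗ≈0 with punchIn-surjective l≢i
      ... | l′ , ≡.refl = h₁ i (trans (sym (laplace P j′)) (sum-0 λ k → trans
        (*-congˡ {x = P j′ k} (vanish l′ (l≢j ∘ ≡.cong (punchIn i)) (trans (sym (u-punchIn l′)) uₗ≈0) k))
        (zeroʳ (P j′ k))))

    open Edge

    edge-dot-G : ∀ {i j} (i≢j : i ≢ j) l →
      u (edge i≢j) l * D ≈ - G i j * G l i + G i i * G l j
    edge-dot-G i≢j l = trans (sym (dot-MG l (u (edge i≢j))))
      (trans (sym (pairing {M = M} M-sym (u (edge i≢j)) (G l))) (dot-Mu (edge i≢j) i≢j (G l)))

    -- The case `l = j` of `edge-dot-G`, where the left side vanishes because the edge vector is
    -- zero at `j`.
    G² : ∀ {i j} → i ≢ j → G i i * G j j ≈ G i j * G i j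
    G² {i} {j} i≢j = sym (x∙y⁻¹≈ε⇒x≈y _ _ (begin
      G i j * G i j - G i i * G j j
        ≈⟨ solve 3 (λ x y z → x :* x :- y :* z := :- ((:- x) :* x :+ y :* z)) refl (G i j) (G i i) (G j j) ⟩
      - (- G i j * G i j + G i i * G j j)
        ≈⟨ -‿cong (+-congʳ (*-congˡ (G-sym i j))) ⟩
      - (- G i j * G j i + G i i * G j j)
        ≈⟨ -‿cong (edge-dot-G i≢j j) ⟨
      - (u (edge i≢j) j * D)
        ≈⟨ -‿cong (trans (*-congʳ (uⱼ (edge i≢j))) (zeroˡ D)) ⟩
      - 0#
        ≈⟨ -0#≈0# ⟩
      0# ∎))

    G≉0 : ∀ {i j} → i ≢ j → ¬ G i j ≈ 0#
    G≉0 {i} {j} i≢j e = ≉0-* (Gᵢᵢ≉0 i) (Gᵢᵢ≉0 j) (trans (G² i≢j) (trans (*-congʳ e) (zeroˡ _)))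

    -- The vectors of two edges sharing `j` are paired through `M`. Both vanish at `j`, so a single
    -- term survives on either side.
    edge-edge : ∀ {i j l} (i≢j : i ≢ j) (j≢l : j ≢ l) →
      G j j * u (edge i≢j) l ≈ - (G i j * u (edge j≢l) i)
    edge-edge {i} {j} {l} i≢j j≢l = begin
      G j j * a l
        ≈⟨ solve 3 (λ g h x → g :* x := (:- h) :* :0 :+ g :* x) refl (G j j) (G j l) (a l) ⟩
      - G j l * 0# + G j j * a l
        ≈⟨ +-congʳ (*-congˡ (uⱼ (edge i≢j))) ⟨
      - G j l * a j + G j j * a l
        ≈⟨ dot-Mu (edge j≢l) j≢l a ⟨
      sum (λ k → (M · b) k * a k)
        ≈⟨ sum-cong (λ k → *-comm ((M · b) k) (a k)) ⟩
      sum (λ k → a k * (M · b) k)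
        ≈⟨ pairing {M = M} M-sym a b ⟨
      sum (λ k → (M · a) k * b k)
        ≈⟨ dot-Mu (edge i≢j) i≢j b ⟩
      - G i j * b i + G i i * b j
        ≈⟨ +-congˡ (*-congˡ (uᵢ (edge j≢l))) ⟩
      - G i j * b i + G i i * 0#
        ≈⟨ solve 3 (λ g h x → (:- g) :* x :+ h :* :0 := :- (g :* x)) refl (G i j) (G i i) (b i) ⟩
      - (G i j * b i) ∎
      where
      a b : Fin (3 ℕ.+ r) → Carrier
      a = u (edge i≢j)
      b = u (edge j≢l)

    -- Apply `edge-edge` at each of the three corners. The three minus signs multiply to one minus
    -- sign in the cyclic identity; `G²`, and cancelling an edge entry and `G j l`, bring it to this
    -- form.
    triangle : ∀ {i j l} → i ≢ j → j ≢ l → l ≢ i → G i i * G j l ≈ - (G i j * G i l)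
    triangle {i} {j} {l} i≢j j≢l l≢i = x∙y⁻¹≈ε⇒x≈y _ _ (cancel (G≉0 j≢l) (cancel
      (uₗ (edge i≢j) l l≢i (j≢l ∘ ≡.sym)) (begin
        x * (G j l * (G i i * G j l - - (G i j * G i l)))
          ≈⟨ solve 5 (λ x a b c d → x :* (a :* (b :* a :- (:- (c :* d)))) :=
               b :* (x :* (a :* a)) :- (c :* (a :* (:- (d :* x))))) refl x (G j l) (G i i) (G i j) (G i l) ⟩
        G i i * (x * (G j l * G j l)) - G i j * (G j l * (- (G i l * x)))
          ≈⟨ +-cong (*-congˡ (*-congˡ (sym (G² j≢l))))
               (-‿cong (*-congˡ (*-congˡ (trans (-‿cong (*-congʳ (G-sym i l)))
                   (sym (edge-edge l≢i i≢j)))))) ⟩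
        G i i * (x * (G j j * G l l)) - G i j * (G j l * (G i i * z))
          ≈⟨ solve 7 (λ a x b c d e z → a :* (x :* (b :* c)) :- d :* (e :* (a :* z)) :=
               a :* (c :* (b :* x) :+ d :* (:- (e :* z)))) refl (G i i) x (G j j) (G l l) (G i j)
                   (G j l) z ⟩
        G i i * (G l l * (G j j * x) + G i j * (- (G j l * z)))
          ≈⟨ *-congˡ (+-cong (*-congˡ (edge-edge i≢j j≢l)) (*-congˡ (sym (edge-edge j≢l l≢i)))) ⟩
        G i i * (G l l * - (G i j * y) + G i j * (G l l * y))
          ≈⟨ solve 4 (λ a b c y → a :* (b :* (:- (c :* y)) :+ c :* (b :* y)) := :0)
              refl (G i i) (G l l) (G i j) y ⟩
        0# ∎)))
      where
      x y z : Carrier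
      x = u (edge i≢j) l
      y = u (edge j≢l) i
      z = u (edge l≢i) j

    -- By `triangle` the two terms of `edge-dot-G` at a third index add up instead of cancelling, so
    -- a nonzero number is a multiple of `D`.
    D≉0 : ¬ D ≈ 0#
    D≉0 e = ≉0-* (≉0-* 2≉0 (Gᵢᵢ≉0 i)) (G≉0 j≢l) (begin
      2# * G i i * G j l
        ≈⟨ solve 2 (λ x y → (:1 :+ :1) :* x :* y := x :* y :+ x :* y) refl (G i i) (G j l) ⟩
      G i i * G j l + G i i * G j l
        ≈⟨ +-cong (triangle i≢j j≢l l≢i) (*-congˡ (G-sym j l)) ⟩
      - (G i j * G i l) + G i i * G l j
        ≈⟨ +-congʳ (trans (-‿cong (*-congˡ (G-sym i l)))
             (solve 2 (λ x y → :- (x :* y) := (:- x) :* y) refl (G i j) (G l i))) ⟩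
      - G i j * G l i + G i i * G l j
        ≈⟨ edge-dot-G i≢j l ⟨
      u (edge i≢j) l * D
        ≈⟨ trans (*-congˡ e) (zeroʳ _) ⟩
      0# ∎)
      where
      i j l : Fin (3 ℕ.+ r)
      i = zero
      j = suc zero
      l = suc (suc zero)
      i≢j : i ≢ j
      i≢j ()
      j≢l : j ≢ l
      j≢l ()
      l≢i : l ≢ i
      l≢i ()

    g : Carrier
    g = G zero zero

    -- The first row of `G`, with its diagonal entry negated so that `gGᵢⱼ` holds at the index
    -- `zero` as well.
    w : Fin (3 ℕ.+ r) → Carrier
    w zero    = - g
    w (suc i) = G zero (suc i)

    w≉0 : ∀ i → ¬ w i ≈ 0#
    w≉0 zero    = ≉0-neg (Gᵢᵢ≉0 zero)
    w≉0 (suc i) = G≉0 {zero} {suc i} λ ()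

    gGᵢⱼ : ∀ {i j} → i ≢ j → g * G i j ≈ - (w i * w j)
    gGᵢⱼ {zero}  {zero}  i≢j = contradiction ≡.refl i≢j
    gGᵢⱼ {zero}  {suc j} i≢j = solve 2 (λ x y → x :* y := :- ((:- x) :* y)) refl g (G zero (suc j))
    gGᵢⱼ {suc i} {zero}  i≢j = trans (*-congˡ (G-sym (suc i) zero))
      (solve 2 (λ x y → x :* y := :- (y :* (:- x))) refl g (G zero (suc i)))
    gGᵢⱼ {suc i} {suc j} i≢j = triangle {zero} {suc i} {suc j} (λ ()) i≢j (λ ())

    gGᵢᵢ : ∀ i → g * G i i ≈ w i * w i
    gGᵢᵢ zero    = solve 1 (λ x → x :* x := (:- x) :* (:- x)) refl g
    gGᵢᵢ (suc i) = G² {zero} {suc i} λ ()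

    e : Fin (3 ℕ.+ r) → Carrier
    e = M · w

    -- g · adj M = 2 W² - w wᵀ with W = diag w, and M · adj M = D.
    g[MG] : ∀ i j → g * (M · G j) i ≈ 2# * M i j * (w j * w j) - e i * w j
    g[MG] i j = begin
      g * (M · G j) i
        ≈⟨ *-congˡ (sum-remove {i = j} (λ k → M i k * G j k)) ⟩
      g * (M i j * G j j + sum (λ k → M i (punchIn j k) * G j (punchIn j k)))
        ≈⟨ trans (distribˡ g _ _) (+-congˡ (*-distribˡ-sum g
            (λ k → M i (punchIn j k) * G j (punchIn j k)))) ⟩
      g * (M i j * G j j) + sum (λ k → g * (M i (punchIn j k) * G j (punchIn j k)))
        ≈⟨ +-cong
             (trans (solve 3 (λ g m h → g :* (m :* h) := m :* (g :* h)) refl g (M i j) (G j j))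
                 (*-congˡ (gGᵢᵢ j)))
             (sum-cong λ k → let k′ = punchIn j k in trans
               (solve 3 (λ g m h → g :* (m :* h) := m :* (g :* h)) refl g (M i k′) (G j k′))
               (trans (*-congˡ (gGᵢⱼ (Fin.punchInᵢ≢i j k ∘ ≡.sym)))
                 (solve 3 (λ m x y → m :* (:- (x :* y)) := (:- x) :* (m :* y))
                     refl (M i k′) (w j) (w k′)))) ⟩
      M i j * (w j * w j) + sum (λ k → - w j * (M i (punchIn j k) * w (punchIn j k)))
        ≈⟨ +-congˡ (*-distribˡ-sum (- w j) (λ k → M i (punchIn j k) * w (punchIn j k))) ⟨
      M i j * (w j * w j) + - w j * rest
        ≈⟨ solve 3 (λ m w r → m :* (w :* w) :+ (:- w) :* r := (:1 :+ :1) :* m :* (w :* w) :-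
            (m :* w :+ r) :* w) refl (M i j) (w j) rest ⟩
      2# * M i j * (w j * w j) - (M i j * w j + rest) * w j
        ≈⟨ +-congˡ (-‿cong (*-congʳ (sum-remove {i = j} (λ k → M i k * w k)))) ⟨
      2# * M i j * (w j * w j) - e i * w j ∎
      where
      rest : Carrier
      rest = sum (λ k → M i (punchIn j k) * w (punchIn j k))

    -- Off the diagonal, `M` times its adjugate vanishes; in `g[MG]` this leaves `w j` times the
    -- claim. Hence all off-diagonal terms of row `i` of `M · w` agree.
    2Mw : ∀ {i j} → i ≢ j → 2# * M i j * w j ≈ e i
    2Mw {i} {j} i≢j = x∙y⁻¹≈ε⇒x≈y _ _ (cancel (w≉0 j) (begin
      w j * (2# * M i j * w j - e i)
        ≈⟨ solve 3 (λ w m e → w :* (m :* w :- e) := m :* (w :* w) :- e :* w) refl (w j) (2# * M i j) (e i) ⟩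
      2# * M i j * (w j * w j) - e i * w j
        ≈⟨ g[MG] i j ⟨
      g * (M · G j) i
        ≈⟨ trans (*-congˡ (laplace-alien M i≢j)) (zeroʳ g) ⟩
      0# ∎))

    sum-const : ∀ n x → sum {n} (λ _ → x) ≈ κ n * x
    sum-const zero    x = sym (zeroˡ x)
    sum-const (suc n) x = trans (+-congˡ (sum-const n x))
        (solve 2 (λ k x → x :+ k :* x := (:1 :+ k) :* x) refl (κ n) x)

    -- Row `i` of `M · w` has 2 + r off-diagonal terms, each half of `e i`, and its total is `e i`,
    -- so the diagonal term is - r / 2 times `e i`. With r = k - 1 this is the diagonal of k I - J.
    2Mwᵢᵢ : ∀ i → 2# * M i i * w i ≈ - (κ r * e i)
    2Mwᵢᵢ i = begin
      2# * M i i * w i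
        ≈⟨ solve 2 (λ a s → a := (a :+ s) :- s) refl (2# * M i i * w i) rest ⟩
      (2# * M i i * w i + rest) - rest
        ≈⟨ +-cong (sym (sum-remove {i = i} (λ k → 2# * M i k * w k)))
            (-‿cong (trans (sum-cong λ k → 2Mw (Fin.punchInᵢ≢i i k ∘ ≡.sym)) (sum-const (2 ℕ.+ r) (e i)))) ⟩
      sum (λ k → 2# * M i k * w k) - κ (2 ℕ.+ r) * e i
        ≈⟨ +-congʳ (trans (sum-cong λ k → *-assoc 2# (M i k) (w k))
            (sym (*-distribˡ-sum 2# (λ k → M i k * w k)))) ⟩
      2# * e i - κ (2 ℕ.+ r) * e i
        ≈⟨ solve 2 (λ e k → (:1 :+ :1) :* e :- (:1 :+ (:1 :+ k)) :* e := :- (k :* e)) refl (e i) (κ r) ⟩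
      - (κ r * e i) ∎
      where
      rest : Carrier
      rest = sum (λ k → 2# * M i (punchIn i k) * w (punchIn i k))

    E : Carrier
    E = e zero * w zero

    -- By symmetry of `M`, the entries at (i, 0) and (0, i) give the same number in `2Mw`.
    E-const : ∀ i → e i * w i ≈ E
    E-const zero    = refl
    E-const (suc i) = begin
      e (suc i) * w (suc i)                 ≈⟨ *-congʳ (2Mw {suc i} {zero} λ ()) ⟨
      2# * M (suc i) zero * w zero * w (suc i)  ≈⟨ *-congʳ (*-congʳ (*-congˡ (M-sym (suc i) zero))) ⟩
      2# * M zero (suc i) * w zero * w (suc i)  ≈⟨ solve 3 (λ a b c → a :* b :* c := a :* c :* b)
          refl (2# * M zero (suc i)) (w zero) (w (suc i)) ⟩
      2# * M zero (suc i) * w (suc i) * w zero  ≈⟨ *-congʳ (2Mw {zero} {suc i} λ ()) ⟩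
      E                                     ∎

    2Mww : ∀ {i j} → i ≢ j → 2# * M i j * (w i * w j) ≈ E
    2Mww {i} {j} i≢j = trans (solve 3 (λ m a b → m :* (a :* b) := m :* b :* a)
        refl (2# * M i j) (w i) (w j))
      (trans (*-congʳ (2Mw i≢j)) (E-const i))

    2Mwwᵢᵢ : ∀ i → 2# * M i i * (w i * w i) ≈ - (κ r * E)
    2Mwwᵢᵢ i = trans (sym (*-assoc _ _ _)) (trans (*-congʳ (2Mwᵢᵢ i))
      (trans (solve 3 (λ k e w → (:- (k :* e)) :* w := :- (k :* (e :* w))) refl (κ r) (e i) (w i))
        (-‿cong (*-congˡ (E-const i)))))

    -- The corner entry of `M` times its adjugate makes `g * D` equal to - k times `E`, and `g * D`
    -- is nonzero.
    E≉0 : ¬ E ≈ 0#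
    E≉0 E≈0 = ≉0-* (Gᵢᵢ≉0 zero) D≉0 (begin
      g * D                                            ≈⟨ *-congˡ (laplace M zero) ⟨
      g * (M · G zero) zero                            ≈⟨ g[MG] zero zero ⟩
      2# * M zero zero * (w zero * w zero) - E          ≈⟨ +-congʳ (2Mwwᵢᵢ zero) ⟩
      - (κ r * E) - E                                  ≈⟨ solve 2 (λ k e → (:- (k :* e)) :- e :=
          (:- (k :+ :1)) :* e) refl (κ r) E ⟩
      - (κ r + 1#) * E                                 ≈⟨ trans (*-congˡ E≈0) (zeroʳ _) ⟩
      0#                                               ∎)

    -- Both sides have the same degree in each entry of `w`, so `w` and `E` drop out. Only entries
    -- of `M` remain, and the relation can be carried to a larger matrix whose submatrices have
    -- different `w`.
    relation₃ : ∀ {i j l} → i ≢ j → j ≢ l → l ≢ i → κ r * (M i j * M i l) ≈ - (M i i * M j l)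
    relation₃ {i} {j} {l} i≢j j≢l l≢i = cancel-≈
      (≉0-* (≉0-* 2≉0 (≉0-* (w≉0 i) (w≉0 j))) (≉0-* 2≉0 (≉0-* (w≉0 i) (w≉0 l)))) (begin
      (2# * (w i * w j)) * (2# * (w i * w l)) * (κ r * (M i j * M i l))
        ≈⟨ solve 7 (λ t a b c k m n → t :* (a :* b) :* (t :* (a :* c)) :* (k :* (m :* n)) :=
             k :* ((t :* m :* (a :* b)) :* (t :* n :* (a :* c))))
                 refl 2# (w i) (w j) (w l) (κ r) (M i j) (M i l) ⟩
      κ r * ((2# * M i j * (w i * w j)) * (2# * M i l * (w i * w l)))
        ≈⟨ *-congˡ (*-cong (2Mww i≢j) (2Mww (l≢i ∘ ≡.sym))) ⟩
      κ r * (E * E)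
        ≈⟨ solve 2 (λ k e → k :* (e :* e) := :- ((:- (k :* e)) :* e)) refl (κ r) E ⟩
      - (- (κ r * E) * E)
        ≈⟨ -‿cong (*-cong (2Mwwᵢᵢ i) (2Mww j≢l)) ⟨
      - ((2# * M i i * (w i * w i)) * (2# * M j l * (w j * w l)))
        ≈⟨ solve 6 (λ t a b c m n → :- ((t :* m :* (a :* a)) :* (t :* n :* (b :* c))) :=
             t :* (a :* b) :* (t :* (a :* c)) :* (:- (m :* n))) refl 2# (w i) (w j) (w l) (M i i) (M j l) ⟩
      (2# * (w i * w j)) * (2# * (w i * w l)) * - (M i i * M j l) ∎)

    relation₂ : ∀ {i j} → i ≢ j → M i i * M j j ≈ (κ r * M i j) * (κ r * M i j)
    relation₂ {i} {j} i≢j = cancel-≈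
      (≉0-* (≉0-* 2≉0 (≉0-* (w≉0 i) (w≉0 i))) (≉0-* 2≉0 (≉0-* (w≉0 j) (w≉0 j)))) (begin
      (2# * (w i * w i)) * (2# * (w j * w j)) * (M i i * M j j)
        ≈⟨ solve 5 (λ t a b m n → t :* (a :* a) :* (t :* (b :* b)) :* (m :* n) :=
             (t :* m :* (a :* a)) :* (t :* n :* (b :* b))) refl 2# (w i) (w j) (M i i) (M j j) ⟩
      (2# * M i i * (w i * w i)) * (2# * M j j * (w j * w j))
        ≈⟨ *-cong (2Mwwᵢᵢ i) (2Mwwᵢᵢ j) ⟩
      - (κ r * E) * - (κ r * E)
        ≈⟨ solve 2 (λ k e → (:- (k :* e)) :* (:- (k :* e)) := k :* k :* (e :* e)) refl (κ r) E ⟩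
      κ r * κ r * (E * E)
        ≈⟨ *-congˡ (*-cong (2Mww i≢j) (2Mww i≢j)) ⟨
      κ r * κ r * ((2# * M i j * (w i * w j)) * (2# * M i j * (w i * w j)))
        ≈⟨ solve 5 (λ t a b k m → k :* k :* ((t :* m :* (a :* b)) :* (t :* m :* (a :* b))) :=
             t :* (a :* a) :* (t :* (b :* b)) :* ((k :* m) :* (k :* m))) refl 2# (w i) (w j) (κ r) (M i j) ⟩
      (2# * (w i * w i)) * (2# * (w j * w j)) * ((κ r * M i j) * (κ r * M i j)) ∎)

    Mᵢⱼ≉0 : ∀ {i j} → i ≢ j → ¬ M i j ≈ 0#
    Mᵢⱼ≉0 {i} {j} i≢j e≈0 = E≉0 (trans (sym (2Mww i≢j))
      (trans (*-congʳ (trans (*-congˡ e≈0) (zeroʳ 2#))) (zeroˡ _)))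

  -- From the submatrices of order k + 2 to the whole matrix

  StrictlyIncreasing : ∀ {m n} → (Fin m → Fin n) → Set
  StrictlyIncreasing f = ∀ {i j} → i <ᶠ j → f i <ᶠ f j

  punchIn-strictlyIncreasing : ∀ {n} (i : Fin (suc n)) → StrictlyIncreasing (punchIn i)
  punchIn-strictlyIncreasing i {j} {k} j<k = ℕ.≰⇒> λ pk≤pj → ℕ.<⇒≱ j<k (Fin.punchIn-cancel-≤ i k j pk≤pj)

  -- If every `x` were hit, a choice of preimages would inject the larger set into the smaller one.
  missed : ∀ {m n} → m ℕ.< n → (g : Fin m → Fin n) → ∃[ x ] (∀ i → g i ≢ x)
  missed {m} {n} m<n g with Fin.any? (λ x → Fin.all? (λ i → ¬? (g i Fin.≟ x)))
  ... | yes p = p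
  ... | no ¬p = contradiction
    (≡.trans (≡.sym (h-section i)) (≡.trans (≡.cong g hi≡hj) (h-section j))) (Fin.<⇒≢ i<j)
    where
    preimage : ∀ x → ∃[ i ] g i ≡ x
    preimage x with Fin.any? (λ i → g i Fin.≟ x)
    ... | yes q = q
    ... | no ¬q = contradiction (x , λ i e → ¬q (i , e)) ¬p
    h : Fin n → Fin m
    h x = proj₁ (preimage x)
    h-section : ∀ x → g (h x) ≡ x
    h-section x = proj₂ (preimage x)
    collision : ∃[ i ] ∃[ j ] (i <ᶠ j × h i ≡ h j)
    collision = Fin.pigeonhole m<n h
    i j : Fin n
    i = proj₁ collision
    j = proj₁ (proj₂ collision)
    i<j : i <ᶠ j
    i<j = proj₁ (proj₂ (proj₂ collision))
    hi≡hj : h i ≡ h j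
    hi≡hj = proj₂ (proj₂ (proj₂ collision))

  -- Shrink the ambient set to size `m`: as `k` is below its size, some index lies outside the image
  -- of `g`; drop it and compose with the increasing map that skips it.
  extend : ∀ {k m n} → k ℕ.< m → m ℕ.≤′ n → (g : Fin k → Fin n) →
    ∃[ f ] (StrictlyIncreasing {m} {n} f × (∀ i → ∃[ j ] f j ≡ g i))
  extend k<m ℕ.≤′-refl g = (λ i → i) , (λ i<j → i<j) , λ i → g i , ≡.refl
  extend {k} {m} {suc n} k<m (ℕ.≤′-step m≤n) g
    with missed (ℕ.<-≤-trans k<m (ℕ.≤-trans (ℕ.≤′⇒≤ m≤n) (ℕ.n≤1+n n))) g
  ... | x , x∉g with extend k<m m≤n (λ i → proj₁ (punchIn-surjective (x∉g i)))
  ... | f , f-inc , f-hit = (punchIn x ∘ f) , (punchIn-strictlyIncreasing x ∘ f-inc) , λ i →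
    proj₁ (f-hit i) , ≡.trans (≡.cong (punchIn x) (proj₂ (f-hit i))) (proj₂ (punchIn-surjective (x∉g i)))

  -- Index sets are increasing maps here, so that deleting an index is composition with `punchIn`.
  AllMinorsOf : ∀ {n} → Matrix Carrier n → ℕ → (Carrier → Set ℓ) → Set ℓ
  AllMinorsOf {n} B m P = ∀ (f : Fin m → Fin n) → StrictlyIncreasing f → P ∣ (λ i j → B (f i) (f j)) ∣

  -- k is q + 2, so `ρ` is k - 1, and the bound leaves room for a submatrix of order k + 2.
  module Rigidity {n q} (B : Matrix Carrier (suc n)) (B-sym : IsSymmetric B) (q≤n : 4 ℕ.+ q ℕ.≤ suc n)
    (h₃ : AllMinorsOf B (1 ℕ.+ q) (λ x → ¬ x ≈ 0#))
    (h₂ : AllMinorsOf B (2 ℕ.+ q) (λ x → x ≈ 0#))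
    (h₁ : AllMinorsOf B (3 ℕ.+ q) (λ x → ¬ x ≈ 0#)) where

    ρ : Carrier
    ρ = κ (suc q)

    module Sub (f : Fin (4 ℕ.+ q) → Fin (suc n)) (f-inc : StrictlyIncreasing f) =
      Bordered (λ i j → B (f i) (f j)) (λ i j → B-sym (f i) (f j))
        (λ i → h₁ (f ∘ punchIn i) (f-inc ∘ punchIn-strictlyIncreasing i))
        (λ i j → h₂ (f ∘ punchIn i ∘ punchIn j)
          (f-inc ∘ punchIn-strictlyIncreasing i ∘ punchIn-strictlyIncreasing j))
        (λ i j l → h₃ (f ∘ punchIn i ∘ punchIn j ∘ punchIn l)
          (f-inc ∘ punchIn-strictlyIncreasing i ∘ punchIn-strictlyIncreasing j
              ∘ punchIn-strictlyIncreasing l))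

    triple : (i j l : Fin (suc n)) → Fin 3 → Fin (suc n)
    triple i j l zero             = i
    triple i j l (suc zero)       = j
    triple i j l (suc (suc zero)) = l

    -- As k + 2 exceeds 3, some submatrix of that order contains the three indices, and the
    -- relations found in it mention no other index.
    relations : ∀ {i j l} → i ≢ j → j ≢ l → l ≢ i →
      ρ * (B i j * B i l) ≈ - (B i i * B j l) × B i i * B j j ≈ (ρ * B i j) * (ρ * B i j) × ¬ B i j ≈ 0#
    relations {i} {j} {l} i≢j j≢l l≢i
      with extend {3} {4 ℕ.+ q} (ℕ.s≤s (ℕ.s≤s (ℕ.s≤s (ℕ.s≤s ℕ.z≤n)))) (ℕ.≤⇒≤′ q≤n) (triple i j l)
    ... | f , f-inc , hit with hit zero | hit (suc zero) | hit (suc (suc zero))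
    ... | a , ≡.refl | b , ≡.refl | c , ≡.refl =
      relation₃ (i≢j ∘ ≡.cong f) (j≢l ∘ ≡.cong f) (l≢i ∘ ≡.cong f) ,
      relation₂ (i≢j ∘ ≡.cong f) , Mᵢⱼ≉0 (i≢j ∘ ≡.cong f)
      where open Sub f f-inc

    another : ∀ (i j : Fin (suc n)) → ∃[ l ] (j ≢ l × l ≢ i)
    another i j with missed (ℕ.<-≤-trans (ℕ.s≤s (ℕ.s≤s (ℕ.s≤s (ℕ.s≤s ℕ.z≤n)))) q≤n) (triple i j j)
    ... | l , e = l , e (suc zero) , e zero ∘ ≡.sym

    B² : ∀ {i j} → i ≢ j → B i i * B j j ≈ (ρ * B i j) * (ρ * B i j)
    B² {i} {j} i≢j with another i j
    ... | l , j≢l , l≢i = proj₁ (proj₂ (relations i≢j j≢l l≢i))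

    B≉0 : ∀ {i j} → i ≢ j → ¬ B i j ≈ 0#
    B≉0 {i} {j} i≢j with another i j
    ... | l , j≢l , l≢i = proj₂ (proj₂ (relations i≢j j≢l l≢i))

    ρ≉0 : ¬ ρ ≈ 0#
    ρ≉0 = char-0 q

    b : Carrier
    b = B zero zero

    b≉0 : ¬ b ≈ 0#
    b≉0 b≈0 with another zero zero
    ... | l , 0≢l , _ = ≉0-* (≉0-* ρ≉0 (B≉0 0≢l)) (≉0-* ρ≉0 (B≉0 0≢l))
      (trans (sym (B² 0≢l)) (trans (*-congʳ b≈0) (zeroˡ _)))

    -- A scaling for all of `B`, read off from its first row; the sign at `zero` accounts for the
    -- off-diagonal entries -1 of `K`.
    w : Fin (suc n) → Carrier
    w zero    = - b
    w (suc i) = ρ * B zero (suc i)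

    w≉0 : ∀ i → ¬ w i ≈ 0#
    w≉0 zero    = ≉0-neg b≉0
    w≉0 (suc i) = ≉0-* ρ≉0 (B≉0 λ ())

    open DiagonalMinusOnes ρ

    -- Each entry is expressed through the first row, by `B²` on the diagonal and by the three-index
    -- relation at `zero` off it. The cleared denominator `ρ * b` carries the sign of `b` over the
    -- reals, which decides between `K` and its negative.
    rigid : ∀ i j → ρ * b * B i j ≈ w i * (w j * K i j)
    rigid zero    zero    = solve 2 (λ r b → r :* b :* b := (:- b) :* ((:- b) :* r)) refl ρ b
    rigid zero    (suc j) = solve 3 (λ r b c → r :* b :* c := (:- b) :* (r :* c :* (:- :1)))
        refl ρ b (B zero (suc j))
    rigid (suc i) zero    = trans (*-congˡ (B-sym (suc i) zero))
      (solve 3 (λ r b c → r :* b :* c := r :* c :* ((:- b) :* (:- :1))) refl ρ b (B zero (suc i)))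
    rigid (suc i) (suc j) with i Fin.≟ j
    ... | yes ≡.refl = begin
      ρ * b * B (suc i) (suc i)    ≈⟨ *-assoc ρ b _ ⟩
      ρ * (b * B (suc i) (suc i))  ≈⟨ *-congˡ (B² {zero} {suc i} λ ()) ⟩
      ρ * (w (suc i) * w (suc i))  ≈⟨ solve 2 (λ r w → r :* (w :* w) := w :* (w :* r)) refl ρ (w (suc i)) ⟩
      w (suc i) * (w (suc i) * ρ)  ≈⟨ *-congˡ (*-congˡ (reflexive (≡.sym (K-diagonal i)))) ⟩
      w (suc i) * (w (suc i) * K i i) ∎
    ... | no i≢j = begin
      ρ * b * B (suc i) (suc j)    ≈⟨ solve 3 (λ r b c → r :* b :* c := :- (r :* (:- (b :* c))))
          refl ρ b _ ⟩
      - (ρ * - (b * B (suc i) (suc j)))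
        ≈⟨ -‿cong (*-congˡ (proj₁ (relations {zero} {suc i} {suc j} (λ ()) (i≢j ∘ Fin.suc-injective)
            (λ ())))) ⟨
      - (ρ * (ρ * (B zero (suc i) * B zero (suc j))))
        ≈⟨ solve 3 (λ r b c → :- (r :* (r :* (b :* c))) := r :* b :* (r :* c :* (:- :1)))
            refl ρ (B zero (suc i)) (B zero (suc j)) ⟩
      w (suc i) * (w (suc j) * - 1#)  ≈⟨ *-congˡ (*-congˡ (reflexive (≡.sym (K-off i≢j)))) ⟩
      w (suc i) * (w (suc j) * K i j) ∎

-- The Cauchy reals as a ring with strict signs

module RealProperties where

  open import Defs
  open import Data.Rational.Base as ℚ using (ℚ; 0ℚ; 1ℚ; ½)
  import Data.Rational.Properties as ℚ
  open import Data.Rational.Solver using (module +-*-Solver)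

  open ℚ.≤-Reasoning

  half>0 : ∀ {ε} → 0ℚ ℚ.< ε → 0ℚ ℚ.< ½ ℚ.* ε
  half>0 {ε} ε>0 = ≡.subst (ℚ._< ½ ℚ.* ε) (ℚ.*-zeroʳ ½) (ℚ.*-monoʳ-<-pos ½ ε>0)

  half+half : ∀ ε → ½ ℚ.* ε ℚ.+ ½ ℚ.* ε ≡ ε
  half+half ε = ≡.trans (≡.sym (ℚ.*-distribʳ-+ ε ½ ½)) (ℚ.*-identityˡ ε)

  half≡ : ∀ ε → ½ ℚ.* ε ≡ ε ℚ.- ½ ℚ.* ε
  half≡ ε = ≡.trans (solve 1 (λ h → h := (h :+ h) :- h) ≡.refl (½ ℚ.* ε))
      (≡.cong (ℚ._- ½ ℚ.* ε) (half+half ε))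
    where open +-*-Solver

  -- `x ≃ y` says that the difference of the two sequences is null, so compatibility of the
  -- operations reduces to closure properties of null sequences.
  Null : (ℕ → ℚ) → Set
  Null z = ∀ ε → 0ℚ ℚ.< ε → ∃[ n₀ ] (∀ m → n₀ ℕ.≤ m → ℚ.∣ z m ∣ ℚ.< ε)

  null-≗ : ∀ {y z} → (∀ m → y m ≡ z m) → Null y → Null z
  null-≗ e y-null ε ε>0 with y-null ε ε>0
  ... | n₀ , small = n₀ , λ m n₀≤m → ≡.subst (λ q → ℚ.∣ q ∣ ℚ.< ε) (e m) (small m n₀≤m)

  null-0 : Null (λ _ → 0ℚ)
  null-0 ε ε>0 = 0 , λ _ _ → ε>0

  null-neg : ∀ {z} → Null z → Null (λ m → ℚ.- z m)
  null-neg {z} z-null ε ε>0 with z-null ε ε>0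
  ... | n₀ , small = n₀ , λ m n₀≤m → ≡.subst (ℚ._< ε) (≡.sym (ℚ.∣-p∣≡∣p∣ (z m))) (small m n₀≤m)

  null-+ : ∀ {y z} → Null y → Null z → Null (λ m → y m ℚ.+ z m)
  null-+ {y} {z} y-null z-null ε ε>0 with y-null (½ ℚ.* ε) (half>0 ε>0) | z-null (½ ℚ.* ε) (half>0 ε>0)
  ... | m₀ , small-y | n₀ , small-z = m₀ ℕ.⊔ n₀ , λ m p → begin-strict
    ℚ.∣ y m ℚ.+ z m ∣         ≤⟨ ℚ.∣p+q∣≤∣p∣+∣q∣ (y m) (z m) ⟩
    ℚ.∣ y m ∣ ℚ.+ ℚ.∣ z m ∣   <⟨ ℚ.+-mono-< (small-y m (ℕ.m⊔n≤o⇒m≤o m₀ n₀ p))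
        (small-z m (ℕ.m⊔n≤o⇒n≤o m₀ n₀ p)) ⟩
    ½ ℚ.* ε ℚ.+ ½ ℚ.* ε       ≡⟨ half+half ε ⟩
    ε                         ∎

  seq-bounded : ∀ x → ∃[ K ] (0ℚ ℚ.< K × ∃[ n₀ ] (∀ m → n₀ ℕ.≤ m → ℚ.∣ seq x m ∣ ℚ.≤ K))
  seq-bounded x with cauchy x 1ℚ (ℚ.positive⁻¹ 1ℚ)
  ... | n₀ , near = 1ℚ ℚ.+ ℚ.∣ seq x n₀ ∣ , ℚ.+-mono-<-≤ (ℚ.positive⁻¹ 1ℚ) (ℚ.0≤∣p∣ (seq x n₀)) , n₀ ,
      λ m n₀≤m → begin
    ℚ.∣ seq x m ∣                             ≡⟨ ≡.cong ℚ.∣_∣ (solve 2 (λ a b → a := (a :- b) :+ b)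
        ≡.refl (seq x m) (seq x n₀)) ⟩
    ℚ.∣ (seq x m ℚ.- seq x n₀) ℚ.+ seq x n₀ ∣   ≤⟨ ℚ.∣p+q∣≤∣p∣+∣q∣ (seq x m ℚ.- seq x n₀) (seq x n₀) ⟩
    ∣ seq x m - seq x n₀ ∣ ℚ.+ ℚ.∣ seq x n₀ ∣   ≤⟨ ℚ.+-monoˡ-≤ ℚ.∣ seq x n₀ ∣
        (ℚ.<⇒≤ (near m n₀ n₀≤m ℕ.≤-refl)) ⟩
    1ℚ ℚ.+ ℚ.∣ seq x n₀ ∣                      ∎
    where open +-*-Solver

  inverse : ∀ {K} → 0ℚ ℚ.< K → ∃[ L ] (0ℚ ℚ.< L × K ℚ.* L ≡ 1ℚ)
  inverse {K} K>0 = ℚ.1/ K , ℚ.positive⁻¹ (ℚ.1/ K) {{ℚ.1/pos⇒pos K}} , ℚ.*-inverseʳ K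
    where
    instance
      K-pos : ℚ.Positive K
      K-pos = ℚ.positive K>0
      K-nonZero : ℚ.NonZero K
      K-nonZero = ℚ.pos⇒nonZero K

  *-pos : ∀ {p q} → 0ℚ ℚ.< p → 0ℚ ℚ.< q → 0ℚ ℚ.< p ℚ.* q
  *-pos {p} {q} p>0 q>0 = ℚ.positive⁻¹ (p ℚ.* q) {{ℚ.pos*pos⇒pos p {{ℚ.positive p>0}} q {{ℚ.positive q>0}}}}

  ∣*∣-bound : ∀ {K L ε} → 0ℚ ℚ.< K → K ℚ.* L ≡ 1ℚ → ∀ a b →
    ℚ.∣ a ∣ ℚ.≤ K → ℚ.∣ b ∣ ℚ.< L ℚ.* ε → ℚ.∣ a ℚ.* b ∣ ℚ.< ε
  ∣*∣-bound {K} {L} {ε} K>0 KL≡1 a b a≤K b<Lε = begin-strict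
    ℚ.∣ a ℚ.* b ∣         ≡⟨ ℚ.∣p*q∣≡∣p∣*∣q∣ a b ⟩
    ℚ.∣ a ∣ ℚ.* ℚ.∣ b ∣   ≤⟨ ℚ.*-monoʳ-≤-nonNeg ℚ.∣ b ∣ {{ℚ.∣-∣-nonNeg b}} a≤K ⟩
    K ℚ.* ℚ.∣ b ∣         <⟨ ℚ.*-monoʳ-<-pos K {{ℚ.positive K>0}} b<Lε ⟩
    K ℚ.* (L ℚ.* ε)       ≡⟨ ℚ.*-assoc K L ε ⟨
    K ℚ.* L ℚ.* ε         ≡⟨ ≡.cong (ℚ._* ε) KL≡1 ⟩
    1ℚ ℚ.* ε              ≡⟨ ℚ.*-identityˡ ε ⟩
    ε                     ∎

  null-* : ∀ x {z} → Null z → Null (λ m → seq x m ℚ.* z m)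
  null-* x {z} z-null ε ε>0 =
    let K , K>0 , m₀ , bounded = seq-bounded x
        L , L>0 , KL≡1         = inverse K>0
        n₀ , small             = z-null (L ℚ.* ε) (*-pos L>0 ε>0)
    in m₀ ℕ.⊔ n₀ , λ m p → ∣*∣-bound K>0 KL≡1 (seq x m) (z m)
         (bounded m (ℕ.m⊔n≤o⇒m≤o m₀ n₀ p)) (small m (ℕ.m⊔n≤o⇒n≤o m₀ n₀ p))

  ≃⇒null : ∀ {x y} → x ≃ y → Null (λ m → seq x m ℚ.- seq y m)
  ≃⇒null (mk≃ close) = close

  ≗⇒≃ : ∀ {x y} → (∀ m → seq x m ≡ seq y m) → x ≃ y
  ≗⇒≃ {x} {y} e = mk≃ (null-≗ (λ m → ≡.trans (≡.sym (ℚ.+-inverseʳ (seq x m)))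
      (≡.cong (λ q → seq x m ℚ.- q) (e m))) null-0)

  ≃-sym : ∀ {x y} → x ≃ y → y ≃ x
  ≃-sym {x} {y} x≃y = mk≃ (null-≗ (λ m → solve 2 (λ a b → :- (a :- b) := b :- a)
      ≡.refl (seq x m) (seq y m)) (null-neg (≃⇒null x≃y)))
    where open +-*-Solver

  ≃-trans : ∀ {x y z} → x ≃ y → y ≃ z → x ≃ z
  ≃-trans {x} {y} {z} x≃y y≃z = mk≃ (null-≗
    (λ m → solve 3 (λ a b c → (a :- b) :+ (b :- c) := a :- c) ≡.refl (seq x m) (seq y m) (seq z m))
    (null-+ (≃⇒null x≃y) (≃⇒null y≃z)))
    where open +-*-Solver

  +ᴿ-cong : ∀ {x y u v} → x ≃ y → u ≃ v → x +ᴿ u ≃ y +ᴿ v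
  +ᴿ-cong {x} {y} {u} {v} x≃y u≃v = mk≃ (null-≗
    (λ m → solve 4 (λ a b c d → (a :- b) :+ (c :- d) := (a :+ c) :- (b :+ d))
        ≡.refl (seq x m) (seq y m) (seq u m) (seq v m))
    (null-+ (≃⇒null x≃y) (≃⇒null u≃v)))
    where open +-*-Solver

  *ᴿ-cong : ∀ {x y u v} → x ≃ y → u ≃ v → x *ᴿ u ≃ y *ᴿ v
  *ᴿ-cong {x} {y} {u} {v} x≃y u≃v = mk≃ (null-≗
    (λ m → solve 4 (λ a b c d → a :* (c :- d) :+ d :* (a :- b) := a :* c :- b :* d)
        ≡.refl (seq x m) (seq y m) (seq u m) (seq v m))
    (null-+ (null-* x (≃⇒null u≃v)) (null-* v (≃⇒null x≃y))))
    where open +-*-Solver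

  -ᴿ-cong : ∀ {x y} → x ≃ y → -ᴿ x ≃ -ᴿ y
  -ᴿ-cong {x} {y} x≃y = mk≃ (null-≗
    (λ m → solve 2 (λ a b → :- (a :- b) := (:- a) :- (:- b)) ≡.refl (seq x m) (seq y m))
    (null-neg (≃⇒null x≃y)))
    where open +-*-Solver

  ℝ-commutativeRing : CommutativeRing 0ℓ 0ℓ
  ℝ-commutativeRing = record
    { Carrier = ℝ
    ; _≈_     = _≃_
    ; _+_     = _+ᴿ_
    ; _*_     = _*ᴿ_
    ; -_      = -ᴿ_
    ; 0#      = 0ℝ
    ; 1#      = 1ℝ
    ; isCommutativeRing = record
      { isRing = record
        { +-isAbelianGroup = record
          { isGroup = record
            { isMonoid = record
              { isSemigroup = record
                { isMagma = record
                  { isEquivalence = record { refl = ≗⇒≃ λ _ → ≡.refl ; sym = ≃-sym ; trans = ≃-trans }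
                  ; ∙-cong = +ᴿ-cong
                  }
                ; assoc = λ x y z → ≗⇒≃ λ m → ℚ.+-assoc (seq x m) (seq y m) (seq z m)
                }
              ; identity = (λ x → ≗⇒≃ λ m → ℚ.+-identityˡ (seq x m)) ,
                  (λ x → ≗⇒≃ λ m → ℚ.+-identityʳ (seq x m))
              }
            ; inverse = (λ x → ≗⇒≃ λ m → ℚ.+-inverseˡ (seq x m)) , (λ x → ≗⇒≃ λ m → ℚ.+-inverseʳ (seq x m))
            ; ⁻¹-cong = -ᴿ-cong
            }
          ; comm = λ x y → ≗⇒≃ λ m → ℚ.+-comm (seq x m) (seq y m)
          }
        ; *-cong = *ᴿ-cong
        ; *-assoc = λ x y z → ≗⇒≃ λ m → ℚ.*-assoc (seq x m) (seq y m) (seq z m)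
        ; *-identity = (λ x → ≗⇒≃ λ m → ℚ.*-identityˡ (seq x m)) , (λ x → ≗⇒≃ λ m → ℚ.*-identityʳ (seq x m))
        ; distrib = (λ x y z → ≗⇒≃ λ m → ℚ.*-distribˡ-+ (seq x m) (seq y m) (seq z m))
                  , (λ x y z → ≗⇒≃ λ m → ℚ.*-distribʳ-+ (seq x m) (seq y m) (seq z m))
        }
      ; *-comm = λ x y → ≗⇒≃ λ m → ℚ.*-comm (seq x m) (seq y m)
      }
    }

  p≤∣p∣ : ∀ p → p ℚ.≤ ℚ.∣ p ∣
  p≤∣p∣ p with ℚ.≤-total 0ℚ p
  ... | inj₁ 0≤p = ℚ.≤-reflexive (≡.sym (ℚ.0≤p⇒∣p∣≡p 0≤p))
  ... | inj₂ p≤0 = ℚ.≤-trans p≤0 (ℚ.0≤∣p∣ p)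

  record EventuallyAbove (x : ℝ) : Set where
    constructor above
    field
      bound   : ℚ
      bound>0 : 0ℚ ℚ.< bound
      from    : ℕ
      holds   : ∀ m → from ℕ.≤ m → bound ℚ.< seq x m

  fromPositive : ∀ {x} → Positive x → EventuallyAbove x
  fromPositive {x} (mk< g g>0 (n₀ , sep)) = above g g>0 n₀
    λ m n₀≤m → ≡.subst (ℚ._< seq x m) (ℚ.+-identityˡ g) (sep m n₀≤m)

  toPositive : ∀ {x} → EventuallyAbove x → Positive x
  toPositive {x} (above g g>0 n₀ sep) = mk< g g>0
    (n₀ , λ m n₀≤m → ≡.subst (ℚ._< seq x m) (≡.sym (ℚ.+-identityˡ g)) (sep m n₀≤m))

  positive-1 : Positive 1ℝ
  positive-1 = toPositive (above ½ (ℚ.positive⁻¹ ½) 0 λ _ _ → ℚ.*<* (ℤ.+<+ (ℕ.s≤s (ℕ.s≤s ℕ.z≤n))))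
    where import Data.Integer.Base as ℤ

  -- Half of the bound for `x` is spent on the distance to `y`; the other half remains.
  positive-≃ : ∀ {x y} → x ≃ y → Positive x → Positive y
  positive-≃ {x} {y} x≃y p =
    let above g g>0 m₀ g<x = fromPositive p
        n₀ , near          = ≃⇒null x≃y (½ ℚ.* g) (half>0 g>0)
    in toPositive (above (½ ℚ.* g) (half>0 g>0) (m₀ ℕ.⊔ n₀) λ m q →
         estimate g (seq x m) (seq y m) (g<x m (ℕ.m⊔n≤o⇒m≤o m₀ n₀ q)) (near m (ℕ.m⊔n≤o⇒n≤o m₀ n₀ q)))
    where
    open +-*-Solver
    estimate : ∀ g a b → g ℚ.< a → ∣ a - b ∣ ℚ.< ½ ℚ.* g → ½ ℚ.* g ℚ.< b
    estimate g a b g<a near = begin-strict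
      ½ ℚ.* g               ≡⟨ half≡ g ⟩
      g ℚ.- ½ ℚ.* g         <⟨ ℚ.+-mono-< g<a (ℚ.neg-antimono-< near) ⟩
      a ℚ.- ∣ a - b ∣       ≤⟨ ℚ.+-monoʳ-≤ a (ℚ.neg-antimono-≤ (p≤∣p∣ (a ℚ.- b))) ⟩
      a ℚ.- (a ℚ.- b)       ≡⟨ solve 2 (λ a b → a :- (a :- b) := b) ≡.refl a b ⟩
      b                     ∎

  positive-+ : ∀ {x y} → Positive x → Positive y → Positive (x +ᴿ y)
  positive-+ p q =
    let above g g>0 m₀ g<x = fromPositive p
        above h h>0 n₀ h<y = fromPositive q
    in toPositive (above (g ℚ.+ h) (ℚ.+-mono-< g>0 h>0) (m₀ ℕ.⊔ n₀)
         λ m r → ℚ.+-mono-< (g<x m (ℕ.m⊔n≤o⇒m≤o m₀ n₀ r)) (h<y m (ℕ.m⊔n≤o⇒n≤o m₀ n₀ r)))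

  positive-* : ∀ {x y} → Positive x → Positive y → Positive (x *ᴿ y)
  positive-* {x} {y} p q =
    let above g g>0 m₀ g<x = fromPositive p
        above h h>0 n₀ h<y = fromPositive q
    in toPositive (above (g ℚ.* h) (*-pos g>0 h>0) (m₀ ℕ.⊔ n₀) λ m r →
         estimate (seq x m) (seq y m) g>0 h>0 (g<x m (ℕ.m⊔n≤o⇒m≤o m₀ n₀ r)) (h<y m (ℕ.m⊔n≤o⇒n≤o m₀ n₀ r)))
    where
    estimate : ∀ {g h} a b → 0ℚ ℚ.< g → 0ℚ ℚ.< h → g ℚ.< a → h ℚ.< b → g ℚ.* h ℚ.< a ℚ.* b
    estimate {g} {h} a b g>0 h>0 g<a h<b = begin-strict
      g ℚ.* h  <⟨ ℚ.*-monoʳ-<-pos g {{ℚ.positive g>0}} h<b ⟩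
      g ℚ.* b  <⟨ ℚ.*-monoˡ-<-pos b {{ℚ.positive (ℚ.<-trans h>0 h<b)}} g<a ⟩
      a ℚ.* b  ∎

  -- If eventually `x` is at most K and the product exceeds h, then `y` exceeds h / K: an upper
  -- bound for `x` replaces its inverse.
  positive-cancel : ∀ {x y} → Positive x → Positive (x *ᴿ y) → Positive y
  positive-cancel {x} {y} p q =
    let above g g>0 m₀ g<x  = fromPositive p
        above h h>0 n₀ h<xy = fromPositive q
        K , K>0 , o₀ , x≤K  = seq-bounded x
        L , L>0 , KL≡1      = inverse K>0
    in toPositive (above (L ℚ.* h) (*-pos L>0 h>0) (m₀ ℕ.⊔ (n₀ ℕ.⊔ o₀)) λ m r →
         let r′ = ℕ.m⊔n≤o⇒n≤o m₀ (n₀ ℕ.⊔ o₀) r in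
         estimate (seq x m) (seq y m) K>0 KL≡1 h>0
           (ℚ.<-trans g>0 (g<x m (ℕ.m⊔n≤o⇒m≤o m₀ (n₀ ℕ.⊔ o₀) r)))
           (h<xy m (ℕ.m⊔n≤o⇒m≤o n₀ o₀ r′)) (x≤K m (ℕ.m⊔n≤o⇒n≤o n₀ o₀ r′)))
    where
    estimate : ∀ {K L h} a b → 0ℚ ℚ.< K → K ℚ.* L ≡ 1ℚ → 0ℚ ℚ.< h → 0ℚ ℚ.< a →
      h ℚ.< a ℚ.* b → ℚ.∣ a ∣ ℚ.≤ K → L ℚ.* h ℚ.< b
    estimate {K} {L} {h} a b K>0 KL≡1 h>0 a>0 h<ab a≤K =
      ℚ.*-cancelˡ-<-nonNeg K {{ℚ.nonNegative (ℚ.<⇒≤ K>0)}} (begin-strict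
        K ℚ.* (L ℚ.* h)  ≡⟨ ℚ.*-assoc K L h ⟨
        K ℚ.* L ℚ.* h    ≡⟨ ≡.trans (≡.cong (ℚ._* h) KL≡1) (ℚ.*-identityˡ h) ⟩
        h                <⟨ h<ab ⟩
        a ℚ.* b          ≤⟨ ℚ.*-monoʳ-≤-nonNeg b {{ℚ.nonNegative (ℚ.<⇒≤ b>0)}}
                              (≡.subst (ℚ._≤ K) (ℚ.0≤p⇒∣p∣≡p (ℚ.<⇒≤ a>0)) a≤K) ⟩
        K ℚ.* b          ∎)
      where
      -- The sign of `b` is needed before `a ≤ K` may be multiplied by it.
      b>0 : 0ℚ ℚ.< b
      b>0 = ℚ.*-cancelˡ-<-nonNeg a {{ℚ.nonNegative (ℚ.<⇒≤ a>0)}}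
        (≡.subst (ℚ._< a ℚ.* b) (≡.sym (ℚ.*-zeroʳ a)) (ℚ.<-trans h>0 h<ab))

  negative⇒positive-neg : ∀ {x} → Negative x → Positive (-ᴿ x)
  negative⇒positive-neg {x} (mk< g g>0 (n₀ , sep)) = toPositive (above g g>0 n₀ λ m n₀≤m →
    ≡.subst (ℚ._< ℚ.- seq x m) (solve 2 (λ x g → :- x :+ (x :+ g) := g) ≡.refl (seq x m) g)
      (≡.subst (ℚ.- seq x m ℚ.+ (seq x m ℚ.+ g) ℚ.<_) (ℚ.+-identityʳ _)
          (ℚ.+-monoʳ-< (ℚ.- seq x m) (sep m n₀≤m))))
    where open +-*-Solver

  positive-neg⇒negative : ∀ {x} → Positive (-ᴿ x) → Negative x
  positive-neg⇒negative {x} p =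
    let above g g>0 n₀ sep = fromPositive p
    in mk< g g>0 (n₀ , λ m n₀≤m → estimate g (seq x m) (sep m n₀≤m))
    where
    estimate : ∀ g a → g ℚ.< ℚ.- a → a ℚ.+ g ℚ.< 0ℚ
    estimate g a g<-a = ≡.subst (a ℚ.+ g ℚ.<_) (ℚ.+-inverseʳ a) (ℚ.+-monoʳ-< a g<-a)

  positive⇒¬zero : ∀ {x} → Positive x → ¬ Zero x
  positive⇒¬zero p z =
    let above g g>0 n₀ sep = fromPositive (positive-≃ z p)
    in ℚ.<-asym g>0 (sep n₀ ℕ.≤-refl)

  -- A constructive substitute for trichotomy. If a term past the Cauchy index had absolute value at
  -- least ε, all terms past that index would share its sign and stay beyond ε / 2, so `x` would be
  -- signed. The order of ℚ is decidable, so each such term is below ε.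
  zero-if-unsigned : ∀ {x} → ¬ Positive x → ¬ Positive (-ᴿ x) → Zero x
  zero-if-unsigned {x} ¬p ¬n = mk≃ λ ε ε>0 → close ε ε>0 (cauchy x (½ ℚ.* ε) (half>0 ε>0))
    where
    open +-*-Solver
    close : ∀ ε → 0ℚ ℚ.< ε → ∃[ n₀ ] (∀ m n → n₀ ℕ.≤ m → n₀ ℕ.≤ n → ∣ seq x m - seq x n ∣ ℚ.< ½ ℚ.* ε) →
      ∃[ n₀ ] (∀ m → n₀ ℕ.≤ m → ∣ seq x m - 0ℚ ∣ ℚ.< ε)
    close ε ε>0 (n₀ , near) = n₀ , λ m n₀≤m → ℚ.≰⇒> λ ε≤∣x∣ →
      ¬∣∣ m n₀≤m (≡.subst (ε ℚ.≤_) (≡.cong ℚ.∣_∣ (ℚ.+-identityʳ (seq x m))) ε≤∣x∣)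
      where
      -- Applied to `x` and to its negative, which oscillate equally.
      large : ∀ y → (∀ a b → ∣ seq y a - seq y b ∣ ≡ ∣ seq x a - seq x b ∣) →
        ∀ m → n₀ ℕ.≤ m → ε ℚ.≤ seq y m → Positive y
      large y same m n₀≤m ε≤y = toPositive (above (½ ℚ.* ε) (half>0 ε>0) n₀ λ n n₀≤n → begin-strict
        ½ ℚ.* ε                                 ≡⟨ half≡ ε ⟩
        ε ℚ.- ½ ℚ.* ε                           <⟨ ℚ.+-mono-≤-< ε≤y (ℚ.neg-antimono-<
                                                     (≡.subst (ℚ._< ½ ℚ.* ε) (≡.sym (same m n))
                                                       (near m n n₀≤m n₀≤n))) ⟩
        seq y m ℚ.- ∣ seq y m - seq y n ∣       ≤⟨ ℚ.+-monoʳ-≤ (seq y m)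
            (ℚ.neg-antimono-≤ (p≤∣p∣ (seq y m ℚ.- seq y n))) ⟩
        seq y m ℚ.- (seq y m ℚ.- seq y n)       ≡⟨ solve 2 (λ a b → a :- (a :- b) := b)
            ≡.refl (seq y m) (seq y n) ⟩
        seq y n                                 ∎)
      ¬∣∣ : ∀ m → n₀ ℕ.≤ m → ¬ ε ℚ.≤ ℚ.∣ seq x m ∣
      ¬∣∣ m n₀≤m ε≤∣x∣ with ℚ.∣p∣≡p∨∣p∣≡-p (seq x m)
      ... | inj₁ e = ¬p (large x (λ _ _ → ≡.refl) m n₀≤m (≡.subst (ε ℚ.≤_) e ε≤∣x∣))
      ... | inj₂ e = ¬n (large (-ᴿ x)
        (λ a b → ≡.trans (≡.cong ℚ.∣_∣ (solve 2 (λ a b → (:- a) :- (:- b) := :- (a :- b))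
            ≡.refl (seq x a) (seq x b)))
          (ℚ.∣-p∣≡∣p∣ (seq x a ℚ.- seq x b)))
        m n₀≤m (≡.subst (ε ℚ.≤_) e ε≤∣x∣))

-- Signs of principal minors and sepr-sequences

module SeprSequences where

  open import Defs
  import Algebra.Definitions.RawSemiring as RawSemiringDefinitions
  import Algebra.Properties.Ring as RingProperties
  open import Data.Bool.Base using (Bool; true; false)
  open import Data.Empty using (⊥; ⊥-elim)
  open import Data.Fin.Subset as Subset using (Subset; inside; outside; ∣_∣)
  import Data.Fin.Subset.Properties as SubsetProperties
  open import Data.List.Base as List using (replicate; _++_)
  import Data.List.Properties as List
  open import Data.Maybe.Base as Maybe using (just)
  open import Data.Maybe.Properties using (just-injective)
  open import Data.Nat.Divisibility using (_∣_; divides; ∣m+n∣m⇒∣n; ∣-refl)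
  open import Data.Vec.Base as Vec using (Vec; []; _∷_; toList)
  import Data.Vec.Properties as Vec

  open RealProperties
  open CommutativeRing ℝ-commutativeRing using
    ( semiring; ring; _*_; -_; _-_; 0#; 1#; sym; trans; reflexive
    ; *-congˡ; *-congʳ; *-assoc; *-identityˡ; zeroʳ
    ; -‿cong; -‿inverseʳ; +-congˡ; +-identityˡ; +-identityʳ
    )
  open RawSemiringDefinitions (Semiring.rawSemiring semiring) using (_^_; product) renaming (_×_ to _×′_)
  open RingProperties ring using (-‿distribʳ-*; -‿distribˡ-*; -‿involutive; -0#≈0#; -1*x≈-x)

  -- A nonzero real is not known to have a sign, so positivity of its square is obtained only under
  -- a double negation.
  positive-square : ∀ {x} → NonZero x → ¬ ¬ Positive (x * x)
  positive-square {x} x≄0 ¬p = x≄0 (zero-if-unsigned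
    (λ p → ¬p (positive-* p p))
    (λ p → ¬p (positive-≃ (trans (sym (-‿distribˡ-* x (- x)))
        (trans (-‿cong (sym (-‿distribʳ-* x x))) (-‿involutive (x * x)))) (positive-* p p))))

  -- Were `y` signed, `x` could have neither sign and would be zero.
  *ᴿ-cancel : ∀ {x y} → NonZero x → x * y ≃ 0# → y ≃ 0#
  *ᴿ-cancel {x} {y} x≄0 xy≃0 = zero-if-unsigned
    (λ y>0 → x≄0 (zero-if-unsigned
      (λ x>0 → positive⇒¬zero (positive-* x>0 y>0) xy≃0)
      (λ x<0 → positive⇒¬zero (positive-* x<0 y>0) (trans (sym (-‿distribˡ-* x y)) -xy≃0))))
    (λ y<0 → x≄0 (zero-if-unsigned
      (λ x>0 → positive⇒¬zero (positive-* x>0 y<0) (trans (sym (-‿distribʳ-* x y)) -xy≃0))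
      (λ x<0 → positive⇒¬zero (positive-* x<0 y<0)
        (trans (sym (-‿distribˡ-* x (- y))) (trans (-‿cong (trans (sym (-‿distribʳ-* x y)) -xy≃0))
            -0#≈0#)))))
    where
    -xy≃0 : - (x * y) ≃ 0#
    -xy≃0 = trans (-‿cong xy≃0) -0#≈0#

  κ-positive : ∀ n → Positive (suc n ×′ 1#)
  κ-positive zero    = positive-≃ (sym (+-identityʳ 1#)) positive-1
  κ-positive (suc n) = positive-+ positive-1 (κ-positive n)

  open CharZeroDomain ℝ-commutativeRing *ᴿ-cancel (λ n → positive⇒¬zero (κ-positive n))
    hiding (∣_∣; missed)

  ^-positive : ∀ {x} → Positive x → ∀ n → Positive (x ^ n)
  ^-positive x>0 zero    = positive-1
  ^-positive x>0 (suc n) = positive-* x>0 (^-positive x>0 n)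

  product≄0 : ∀ {n} (w : Fin n → ℝ) → (∀ i → NonZero (w i)) → NonZero (product w)
  product≄0 {zero}  w w≄0 = positive⇒¬zero positive-1
  product≄0 {suc n} w w≄0 = ≉0-* (w≄0 zero) (product≄0 (w ∘ suc) (w≄0 ∘ suc))

  -- The two patterns contain only terms under which all minors of one order share a sign; the other
  -- terms get the empty condition.
  HasSign : SeprTerm → ℝ → Set
  HasSign A⁺ = Positive
  HasSign A⁻ = Negative
  HasSign N  = Zero
  HasSign _  = λ _ → ⊥

  hasSign-≃ : ∀ t {x y} → x ≃ y → HasSign t x → HasSign t y
  hasSign-≃ A⁺ x≃y p = positive-≃ x≃y p
  hasSign-≃ A⁻ x≃y p = positive-neg⇒negative (positive-≃ (-‿cong x≃y) (negative⇒positive-neg p))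
  hasSign-≃ N  x≃y p = trans (sym x≃y) p

  hasSign-scale : ∀ t {p x} → Positive p → HasSign t x → HasSign t (p * x)
  hasSign-scale A⁺ p>0 h = positive-* p>0 h
  hasSign-scale A⁻ {p} {x} p>0 h = positive-neg⇒negative
    (positive-≃ (sym (-‿distribʳ-* p x)) (positive-* p>0 (negative⇒positive-neg h)))
  hasSign-scale N  {p} p>0 h = trans (*-congˡ h) (zeroʳ p)

  hasSign-unscale : ∀ t {p x} → Positive p → HasSign t (p * x) → HasSign t x
  hasSign-unscale A⁺ p>0 h = positive-cancel p>0 h
  hasSign-unscale A⁻ {p} {x} p>0 h = positive-neg⇒negative (positive-cancel p>0
    (positive-≃ (-‿distribʳ-* p x) (negative⇒positive-neg h)))
  hasSign-unscale N  p>0 h = *ᴿ-cancel (positive⇒¬zero p>0) h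

  hasSign-neg : ∀ t {x} → HasSign t x → HasSign (neg t) (- x)
  hasSign-neg A⁺ {x} h = positive-neg⇒negative (positive-≃ (sym (-‿involutive x)) h)
  hasSign-neg A⁻ h = negative⇒positive-neg h
  hasSign-neg N  h = trans (-‿cong h) -0#≈0#

  neg^ : ℕ → SeprTerm → SeprTerm
  neg^ zero    t = t
  neg^ (suc j) t = neg (neg^ j t)

  hasSign-neg^ : ∀ j t {x} → HasSign t x → HasSign (neg^ j t) ((- 1#) ^ j * x)
  hasSign-neg^ zero    t {x} h = hasSign-≃ t (sym (*-identityˡ x)) h
  hasSign-neg^ (suc j) t {x} h = hasSign-≃ (neg^ (suc j) t)
    (trans (sym (-1*x≈-x _)) (sym (*-assoc (- 1#) ((- 1#) ^ j) x)))
        (hasSign-neg (neg^ j t) (hasSign-neg^ j t h))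

  -- Up to a positive factor, a minor of k I - J of order j is k - j.
  signOfDifference : ℕ → ℕ → SeprTerm
  signOfDifference zero    zero    = N
  signOfDifference zero    (suc j) = A⁻
  signOfDifference (suc k) zero    = A⁺
  signOfDifference (suc k) (suc j) = signOfDifference k j

  difference-hasSign : ∀ k j → HasSign (signOfDifference k j) (κ k - κ j)
  difference-hasSign zero    zero    = -‿inverseʳ 0#
  difference-hasSign zero    (suc j) = positive-neg⇒negative (positive-≃
    (sym (trans (-‿cong (+-identityˡ (- κ (suc j)))) (-‿involutive (κ (suc j))))) (κ-positive j))
  difference-hasSign (suc k) zero    = positive-≃ (sym (trans (+-congˡ -0#≈0#) (+-identityʳ _)))
      (κ-positive k)
  difference-hasSign (suc k) (suc j) = hasSign-≃ (signOfDifference k j) (sym (κ-suc-minus k j))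
      (difference-hasSign k j)

  -- The terms of the sepr-sequence of k I - J and of its negative.
  pattern⟨_⟩ : Bool → ℕ → ℕ → SeprTerm
  pattern⟨ false ⟩ k j = signOfDifference k j
  pattern⟨ true  ⟩ k j = neg^ j (signOfDifference k j)

  negateIf : Bool → ℝ → ℝ
  negateIf false x = x
  negateIf true  x = - x

  module _ (r : ℕ) where
    open DiagonalMinusOnes (κ r)

    det-K-hasSign : ∀ n → HasSign (signOfDifference (suc r) n) (det ℝ-rawRing (K {n}))
    det-K-hasSign zero    = positive-1
    det-K-hasSign (suc n) = hasSign-≃ (signOfDifference r n) (sym (det-K n))
      (hasSign-scale (signOfDifference r n) (^-positive (κ-positive r) n) (difference-hasSign r n))

    enum-injective : ∀ {n} (α : Subset n) {i j} → enum α i ≡ enum α j → i ≡ j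
    enum-injective (outside ∷ α) e = enum-injective α (Fin.suc-injective e)
    enum-injective (inside ∷ α) {zero}  {zero}  e = ≡.refl
    enum-injective (inside ∷ α) {suc i} {suc j} e = ≡.cong suc (enum-injective α (Fin.suc-injective e))

    -- Multiply by a power of `y`, apply the congruence to `K`, and cancel the positive factors.
    -- Positivity of the square is asked of the caller, who may have it only under a double
    -- negation.
    minor-hasSign : ∀ s {n} (B : Matrix ℝ n) {y} (w : Fin n → ℝ) → Positive y →
      (∀ i j → y * B i j ≃ negateIf s (w i) * (w j * K i j)) →
      ∀ α → Positive (product (w ∘ enum α) * product (w ∘ enum α)) →
      HasSign (pattern⟨ s ⟩ (suc r) ∣ α ∣) (minor B α)
    minor-hasSign s B {y} w y>0 e α P>0 = hasSign-unscale (pattern⟨ s ⟩ (suc r) m) (^-positive y>0 m)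
        (scaled s e)
      where
      m : ℕ
      m = ∣ α ∣
      entry : ∀ (a : ℝ → ℝ) → (∀ i j → y * B i j ≃ a (w i) * (w j * K i j)) → ∀ i j →
        y * principalSubmatrix B α i j ≃ a (w (enum α i)) * (w (enum α j) * K i j)
      entry a e i j = trans (e (enum α i) (enum α j))
        (*-congˡ (*-congˡ (reflexive (K-injective (enum α) (enum-injective α) i j))))
      scaled : ∀ s → (∀ i j → y * B i j ≃ negateIf s (w i) * (w j * K i j)) →
        HasSign (pattern⟨ s ⟩ (suc r) m) (y ^ m * minor B α)
      scaled false e = hasSign-≃ (signOfDifference (suc r) m)
        (sym (det-congruence⁺ y (w ∘ enum α) (principalSubmatrix B α) K (entry (λ x → x) e)))
        (hasSign-scale (signOfDifference (suc r) m) P>0 (det-K-hasSign m))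
      scaled true e = hasSign-≃ (neg^ m (signOfDifference (suc r) m))
        (sym (det-congruence⁻ y (w ∘ enum α) (principalSubmatrix B α) K (entry -_ e)))
        (hasSign-neg^ m (signOfDifference (suc r) m)
          (hasSign-scale (signOfDifference (suc r) m) P>0 (det-K-hasSign m)))

  negative⇒¬zero : ∀ {x} → Negative x → ¬ Zero x
  negative⇒¬zero x<0 x≃0 = positive⇒¬zero (negative⇒positive-neg x<0) (trans (-‿cong x≃0) -0#≈0#)

  positive⇒¬negative : ∀ {x} → Positive x → ¬ Negative x
  positive⇒¬negative {x} x>0 x<0 =
    positive⇒¬zero (positive-+ x>0 (negative⇒positive-neg x<0)) (-‿inverseʳ x)

  A⇒allNonZero : ∀ {n} (B : Matrix ℝ n) j t → underlying t ≡ A → HasTerm B j t → AllMinors B j NonZero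
  A⇒allNonZero B j A* _ (h , _)         = h
  A⇒allNonZero B j A⁺ _ h α e           = positive⇒¬zero (h α e)
  A⇒allNonZero B j A⁻ _ h α e           = negative⇒¬zero (h α e)

  N⇒allZero : ∀ {n} (B : Matrix ℝ n) j t → underlying t ≡ N → HasTerm B j t → AllMinors B j Zero
  N⇒allZero B j N _ h = h

  hasSign⇒hasTerm : ∀ t {n} (B : Matrix ℝ n) j → ∃[ α ] ∣_∣ {n} α ≡ j →
    (∀ (α : Subset n) → ∣ α ∣ ≡ j → HasSign t (minor B α)) → HasTerm B j t
  hasSign⇒hasTerm A⁺ B j _ h = h
  hasSign⇒hasTerm A⁻ B j _ h = h
  hasSign⇒hasTerm N  B j _ h = h
  hasSign⇒hasTerm A* B j (α , e) h = ⊥-elim (h α e)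
  hasSign⇒hasTerm S* B j (α , e) h = ⊥-elim (h α e)
  hasSign⇒hasTerm S⁺ B j (α , e) h = ⊥-elim (h α e)
  hasSign⇒hasTerm S⁻ B j (α , e) h = ⊥-elim (h α e)

  -- A wrong term is refuted by a single minor, and a refutation can use a doubly negated sign.
  hasTerm-unique : ∀ {n} (B : Matrix ℝ n) j {t t′} → ∃[ α ] ∣_∣ {n} α ≡ j → HasTerm B j t →
    (∀ (α : Subset n) → ∣ α ∣ ≡ j → ¬ ¬ HasSign t′ (minor B α)) → t ≡ t′
  hasTerm-unique B j {A*} {A⁺} _ (_ , _ , α , e , x<0) h = ⊥-elim (h α e λ x>0 → positive⇒¬negative x>0 x<0)
  hasTerm-unique B j {A⁺} {A⁺} _ _ h = ≡.refl
  hasTerm-unique B j {A⁻} {A⁺} (α , e) x<0 h = ⊥-elim (h α e λ x>0 → positive⇒¬negative x>0 (x<0 α e))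
  hasTerm-unique B j {N}  {A⁺} (α , e) x≃0 h = ⊥-elim (h α e λ x>0 → positive⇒¬zero x>0 (x≃0 α e))
  hasTerm-unique B j {S*} {A⁺} _ (_ , _ , α , e , x≃0) h = ⊥-elim (h α e λ x>0 → positive⇒¬zero x>0 x≃0)
  hasTerm-unique B j {S⁺} {A⁺} _ ((α , e , x≃0) , _) h = ⊥-elim (h α e λ x>0 → positive⇒¬zero x>0 x≃0)
  hasTerm-unique B j {S⁻} {A⁺} _ ((α , e , x≃0) , _) h = ⊥-elim (h α e λ x>0 → positive⇒¬zero x>0 x≃0)
  hasTerm-unique B j {A*} {A⁻} _ (_ , (α , e , x>0) , _) h = ⊥-elim (h α e (positive⇒¬negative x>0))
  hasTerm-unique B j {A⁺} {A⁻} (α , e) x>0 h = ⊥-elim (h α e (positive⇒¬negative (x>0 α e)))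
  hasTerm-unique B j {A⁻} {A⁻} _ _ h = ≡.refl
  hasTerm-unique B j {N}  {A⁻} (α , e) x≃0 h = ⊥-elim (h α e λ x<0 → negative⇒¬zero x<0 (x≃0 α e))
  hasTerm-unique B j {S*} {A⁻} _ (_ , _ , α , e , x≃0) h = ⊥-elim (h α e λ x<0 → negative⇒¬zero x<0 x≃0)
  hasTerm-unique B j {S⁺} {A⁻} _ ((α , e , x≃0) , _) h = ⊥-elim (h α e λ x<0 → negative⇒¬zero x<0 x≃0)
  hasTerm-unique B j {S⁻} {A⁻} _ ((α , e , x≃0) , _) h = ⊥-elim (h α e λ x<0 → negative⇒¬zero x<0 x≃0)
  hasTerm-unique B j {A*} {N} (α , e) (x≄0 , _) h = ⊥-elim (h α e (x≄0 α e))
  hasTerm-unique B j {A⁺} {N} (α , e) x>0 h = ⊥-elim (h α e (positive⇒¬zero (x>0 α e)))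
  hasTerm-unique B j {A⁻} {N} (α , e) x<0 h = ⊥-elim (h α e (negative⇒¬zero (x<0 α e)))
  hasTerm-unique B j {N}  {N} _ _ h = ≡.refl
  hasTerm-unique B j {S*} {N} _ ((α , e , x>0) , _) h = ⊥-elim (h α e (positive⇒¬zero x>0))
  hasTerm-unique B j {S⁺} {N} _ (_ , (α , e , x≄0) , _) h = ⊥-elim (h α e x≄0)
  hasTerm-unique B j {S⁻} {N} _ (_ , (α , e , x≄0) , _) h = ⊥-elim (h α e x≄0)
  hasTerm-unique B j {t′ = A*} (α , e) _ h = ⊥-elim (h α e λ ())
  hasTerm-unique B j {t′ = S*} (α , e) _ h = ⊥-elim (h α e λ ())
  hasTerm-unique B j {t′ = S⁺} (α , e) _ h = ⊥-elim (h α e λ ())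
  hasTerm-unique B j {t′ = S⁻} (α , e) _ h = ⊥-elim (h α e λ ())

  subsetOfSize : ∀ {j n} → j ℕ.≤ n → ∃[ α ] ∣_∣ {n} α ≡ j
  subsetOfSize {n = n} ℕ.z≤n = Subset.⊥ , SubsetProperties.∣⊥∣≡0 n
  subsetOfSize (ℕ.s≤s j≤n) with subsetOfSize j≤n
  ... | α , e = inside ∷ α , ≡.cong suc e

  lower : ∀ {m n} (f : Fin m → Fin (suc n)) → StrictlyIncreasing f → (∀ i → zero ≢ f i) →
    ∃[ g ] (StrictlyIncreasing {m} {n} g × (∀ i → suc (g i) ≡ f i))
  lower f f-inc 0≢f = (λ i → punchOut (0≢f i)) ,
    (λ {i} {j} i<j → ℕ.s<s⁻¹ (≡.subst₂ _<ᶠ_ (≡.sym (suc-g i)) (≡.sym (suc-g j)) (f-inc i<j))) , suc-g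
    where
    suc-g : ∀ i → suc (punchOut (0≢f i)) ≡ f i
    suc-g i = Fin.punchIn-punchOut (0≢f i)

  -- Recursion on the ambient set, deciding whether `zero` is hit; an increasing map can hit it only
  -- at its first argument. The `cast` bridges a size that equals `m` only propositionally.
  increasing⇒subset : ∀ {m n} (f : Fin m → Fin n) → StrictlyIncreasing f →
    ∃[ α ] ∃[ e ] (∀ i → f (cast {∣ α ∣} e i) ≡ enum α i)
  increasing⇒subset {zero}  {zero}  f f-inc = [] , ≡.refl , λ ()
  increasing⇒subset {suc m} {zero}  f f-inc with () ← f zero
  increasing⇒subset {m} {suc n} f f-inc = go f f-inc
    where
    avoidingZero : ∀ {m} (f : Fin m → Fin (suc n)) → StrictlyIncreasing f → (∀ i → zero ≢ f i) →
      ∃[ α ] ∃[ e ] (∀ i → f (cast {∣ α ∣} e i) ≡ enum α i)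
    avoidingZero f f-inc 0≢f =
      let g , g-inc , suc-g = lower f f-inc 0≢f
          α , e , h         = increasing⇒subset g g-inc
      in outside ∷ α , e , λ i → ≡.trans (≡.sym (suc-g (cast e i))) (≡.cong suc (h i))
    go : ∀ {m} (f : Fin m → Fin (suc n)) → StrictlyIncreasing f →
      ∃[ α ] ∃[ e ] (∀ i → f (cast {∣ α ∣} e i) ≡ enum α i)
    go {zero}  f f-inc = avoidingZero f f-inc λ ()
    go {suc m} f f-inc with zero Fin.≟ f zero
    ... | no 0≢f0 = avoidingZero f f-inc λ
      { zero → 0≢f0
      ; (suc i) 0≡fi → ℕ.n≮0 (≡.subst (f zero <ᶠ_) (≡.sym 0≡fi) (f-inc {zero} {suc i} (ℕ.s≤s ℕ.z≤n)))
      }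
    ... | yes 0≡f0 =
      let g , g-inc , suc-g = lower (f ∘ suc) (λ i<j → f-inc (ℕ.s≤s i<j)) λ i 0≡fi →
            ℕ.<-irrefl (≡.cong toℕ (≡.trans (≡.sym 0≡f0) 0≡fi)) (f-inc {zero} {suc i} (ℕ.s≤s ℕ.z≤n))
          α , e , h         = increasing⇒subset g g-inc
      in inside ∷ α , ≡.cong suc e , λ
        { zero    → ≡.sym 0≡f0
        ; (suc i) → ≡.trans (≡.sym (suc-g (cast e i))) (≡.cong suc (h i))
        }

  minor-reindex : ∀ {m n} (B : Matrix ℝ n) (f : Fin m → Fin n) (α : Subset n) (e : ∣ α ∣ ≡ m) →
    (∀ i → f (cast e i) ≡ enum α i) → minor B α ≃ det ℝ-rawRing (λ i j → B (f i) (f j))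
  minor-reindex B f α ≡.refl h = det-cong (principalSubmatrix B α) (λ i j → B (f i) (f j)) λ i j →
    reflexive (≡.sym (≡.cong₂ B (f≗enum i) (f≗enum j)))
    where
    f≗enum : ∀ i → f i ≡ enum α i
    f≗enum i = ≡.trans (≡.cong f (≡.sym (Fin.cast-is-id ≡.refl i))) (h i)

  allMinors⇒allMinorsOf : ∀ {n} (B : Matrix ℝ n) k {P : ℝ → Set} → (∀ {x y} → x ≃ y → P x → P y) →
    AllMinors B k P → AllMinorsOf B k P
  allMinors⇒allMinorsOf B k P-≃ h f f-inc =
    let α , e , f≗enum = increasing⇒subset f f-inc
    in P-≃ (minor-reindex B f α e f≗enum) (h α e)

  ‼-lookup : ∀ {a n} {X : Set a} (v : Vec X n) i → v ‼ suc (toℕ i) ≡ just (Vec.lookup v i)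
  ‼-lookup (x ∷ v) zero    = ≡.refl
  ‼-lookup (x ∷ v) (suc i) = ‼-lookup v i

  ‼-just : ∀ {a n} {X : Set a} (v : Vec X n) j {x} → v ‼ j ≡ just x →
    ∃[ i ] (j ≡ suc (toℕ i) × Vec.lookup v i ≡ x)
  ‼-just []      (suc j)       ()
  ‼-just (x ∷ v) (suc zero)    ≡.refl = zero , ≡.refl , ≡.refl
  ‼-just (x ∷ v) (suc (suc j)) e with ‼-just v (suc j) e
  ... | i , j≡ , l = suc i , ≡.cong suc j≡ , l

  ‼-epr : ∀ {n} (σ : Vec SeprTerm n) j {ℓ} → epr σ ‼ j ≡ just ℓ →
    ∃[ i ] (j ≡ suc (toℕ i) × underlying (Vec.lookup σ i) ≡ ℓ)
  ‼-epr σ j e with ‼-just (epr σ) j e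
  ... | i , j≡ , l = i , j≡ , ≡.trans (≡.sym (Vec.lookup-map i underlying σ)) l

  -- Comparing codes in ℕ that can be decoded avoids a table of forty-nine cases.
  _≟ˢ_ : (t u : SeprTerm) → Dec (t ≡ u)
  t ≟ˢ u = map′ (λ e → ≡.trans (≡.sym (decode-code t)) (≡.trans (≡.cong decode e) (decode-code u)))
      (≡.cong code)
    (code t ℕ.≟ code u)
    where
    code : SeprTerm → ℕ
    code A* = 0
    code A⁺ = 1
    code A⁻ = 2
    code N  = 3
    code S* = 4
    code S⁺ = 5
    code S⁻ = 6
    decode : ℕ → SeprTerm
    decode 0 = A*
    decode 1 = A⁺
    decode 2 = A⁻
    decode 3 = N
    decode 4 = S*
    decode 5 = S⁺
    decode _ = S⁻
    decode-code : ∀ t → decode (code t) ≡ t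
    decode-code A* = ≡.refl
    decode-code A⁺ = ≡.refl
    decode-code A⁻ = ≡.refl
    decode-code N  = ≡.refl
    decode-code S* = ≡.refl
    decode-code S⁺ = ≡.refl
    decode-code S⁻ = ≡.refl

  FollowsPattern : ∀ {n} → Bool → ℕ → Vec SeprTerm n → Set
  FollowsPattern s k σ = ∀ i → Vec.lookup σ i ≡ pattern⟨ s ⟩ k (suc (toℕ i))

  sepr⇒pattern : ∀ {q n} (σ : Vec SeprTerm (suc n)) (B : Matrix ℝ (suc n)) → 4 ℕ.+ q ℕ.≤ suc n →
    epr σ ‼ (1 ℕ.+ q) ≡ just A → epr σ ‼ (2 ℕ.+ q) ≡ just N → epr σ ‼ (3 ℕ.+ q) ≡ just A →
    Symmetric B → HasSepr B σ → ∃[ s ] FollowsPattern s (2 ℕ.+ q) σ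
  sepr⇒pattern {q} {n} σ B q≤n e₁ e₂ e₃ B-sym σ-sepr = decide
    where
    allNonZero : ∀ {j} → epr σ ‼ j ≡ just A → AllMinors B j NonZero
    allNonZero {j} e with ‼-epr σ j e
    ... | i , ≡.refl , u = A⇒allNonZero B j (Vec.lookup σ i) u (σ-sepr i)
    allZero : ∀ {j} → epr σ ‼ j ≡ just N → AllMinors B j Zero
    allZero {j} e with ‼-epr σ j e
    ... | i , ≡.refl , u = N⇒allZero B j (Vec.lookup σ i) u (σ-sepr i)
    nonZero-≃ : ∀ {x y} → x ≃ y → NonZero x → NonZero y
    nonZero-≃ x≃y x≄0 y≃0 = x≄0 (trans x≃y y≃0)
    open Rigidity {n} {q} B B-sym q≤n
      (allMinors⇒allMinorsOf B (1 ℕ.+ q) nonZero-≃ (allNonZero e₁))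
      (allMinors⇒allMinorsOf B (2 ℕ.+ q) (λ x≃y x≃0 → trans (sym x≃y) x≃0) (allZero e₂))
      (allMinors⇒allMinorsOf B (3 ℕ.+ q) nonZero-≃ (allNonZero e₃))
    open DiagonalMinusOnes ρ using (K)

    follows : ∀ s {y} → Positive y → (∀ i j → y * B i j ≃ negateIf s (w i) * (w j * K i j)) →
      FollowsPattern s (2 ℕ.+ q) σ
    follows s y>0 e i = hasTerm-unique B (suc (toℕ i)) (subsetOfSize (Fin.toℕ<n i)) (σ-sepr i)
      -- The goal is now a contradiction, so the doubly negated positivity of the square may be
      -- used.
      λ α ∣α∣≡ ¬sign → positive-square (product≄0 (w ∘ enum α) (λ i → w≉0 (enum α i))) λ P>0 →
        ¬sign (≡.subst (λ m → HasSign (pattern⟨ s ⟩ (2 ℕ.+ q) m) (minor B α)) ∣α∣≡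
          (minor-hasSign (suc q) s B w y>0 e α P>0))

    follows⁺ : Positive b → FollowsPattern false (2 ℕ.+ q) σ
    follows⁺ b>0 = follows false {ρ * b} (positive-* (κ-positive q) b>0) rigid

    follows⁻ : Positive (- b) → FollowsPattern true (2 ℕ.+ q) σ
    -- The scalar has to be positive, so the sign of `b` moves to the left factor `w i`.
    follows⁻ b<0 = follows true {ρ * - b} (positive-* (κ-positive q) b<0) λ i j → trans
      (*-congʳ (sym (-‿distribʳ-* ρ b)))
      (trans (sym (-‿distribˡ-* (ρ * b) (B i j))) (trans (-‿cong (rigid i j))
          (-‿distribˡ-* (w i) (w j * K i j))))

    -- The sign of b cannot be computed, but following a pattern is decidable,
    -- so it is enough that the two patterns do not both fail.
    decide : ∃[ s ] FollowsPattern s (2 ℕ.+ q) σ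
    decide with Fin.all? (λ i → Vec.lookup σ i ≟ˢ pattern⟨ false ⟩ (2 ℕ.+ q) (suc (toℕ i)))
              | Fin.all? (λ i → Vec.lookup σ i ≟ˢ pattern⟨ true ⟩ (2 ℕ.+ q) (suc (toℕ i)))
    ... | yes p | _     = false , p
    ... | no _  | yes p = true , p
    ... | no ¬p | no ¬q = ⊥-elim (b≉0 (zero-if-unsigned (¬p ∘ follows⁺) (¬q ∘ follows⁻)))

  pattern⇒sepr : ∀ s r {n} (σ : Vec SeprTerm n) → FollowsPattern s (suc r) σ →
    ∃[ B ] (Symmetric {n} B × HasSepr B σ)
  pattern⇒sepr s r {n} σ σ-follows = B , B-sym , λ i → ≡.subst (HasTerm B (suc (toℕ i)))
      (≡.sym (σ-follows i))
    (hasSign⇒hasTerm (pattern⟨ s ⟩ (suc r) (suc (toℕ i))) B (suc (toℕ i)) (subsetOfSize (Fin.toℕ<n i))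
      λ α ∣α∣≡ → ≡.subst (λ m → HasSign (pattern⟨ s ⟩ (suc r) m) (minor B α)) ∣α∣≡
        (minor-hasSign r s B (λ _ → 1#) positive-1 (λ i j → *-identityˡ (B i j)) α
          (positive-* (ones ∣ α ∣) (ones ∣ α ∣))))
    where
    open DiagonalMinusOnes (κ r) using (K)
    -- The factors 1 are kept so that the hypothesis of `minor-hasSign` holds with all scaling
    -- entries equal to 1.
    B : Matrix ℝ n
    B i j = negateIf s 1# * (1# * K i j)
    K-sym : ∀ {n} (i j : Fin n) → K i j ≡ K j i
    K-sym zero    zero    = ≡.refl
    K-sym zero    (suc j) = ≡.refl
    K-sym (suc i) zero    = ≡.refl
    K-sym (suc i) (suc j) = K-sym i j
    B-sym : Symmetric B
    B-sym i j = reflexive (≡.cong (λ x → negateIf s 1# * (1# * x)) (K-sym i j))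
    ones : ∀ m → Positive (product {m} (λ _ → 1#))
    ones zero    = positive-1
    ones (suc m) = positive-* positive-1 (ones m)

  -- The two patterns as sequences of terms

  signOfDifference-refl : ∀ k → signOfDifference k k ≡ N
  signOfDifference-refl zero    = ≡.refl
  signOfDifference-refl (suc k) = signOfDifference-refl k

  signOfDifference-pred : ∀ k → signOfDifference (suc k) k ≡ A⁺
  signOfDifference-pred zero    = ≡.refl
  signOfDifference-pred (suc k) = signOfDifference-pred k

  signOfDifference-> : ∀ k d → signOfDifference k (k ℕ.+ suc d) ≡ A⁻
  signOfDifference-> zero    d = ≡.refl
  signOfDifference-> (suc k) d = signOfDifference-> k d

  signOfDifference-N : ∀ k j → signOfDifference k j ≡ N → k ≡ j
  signOfDifference-N zero    zero    e = ≡.refl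
  signOfDifference-N (suc k) (suc j) e = ≡.cong suc (signOfDifference-N k j e)

  -- The sign of k - j changes only on reaching and on leaving j = k; these two steps are the ones
  -- missing from α.
  signOfDifference-step : ∀ k j → suc j ≢ k → j ≢ k → signOfDifference k (suc j) ≡ signOfDifference k j
  signOfDifference-step zero          zero    _    j≢k  = contradiction ≡.refl j≢k
  signOfDifference-step zero          (suc j) _    _    = ≡.refl
  signOfDifference-step (suc zero)    zero    1≢k  _    = contradiction ≡.refl 1≢k
  signOfDifference-step (suc (suc k)) zero    _    _    = ≡.refl
  signOfDifference-step (suc k)       (suc j) sj≢k j≢k  =
    signOfDifference-step k j (sj≢k ∘ ≡.cong suc) (j≢k ∘ ≡.cong suc)

  neg-involutive : ∀ t → neg (neg t) ≡ t
  neg-involutive A* = ≡.refl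
  neg-involutive A⁺ = ≡.refl
  neg-involutive A⁻ = ≡.refl
  neg-involutive N  = ≡.refl
  neg-involutive S* = ≡.refl
  neg-involutive S⁺ = ≡.refl
  neg-involutive S⁻ = ≡.refl

  neg^-even : ∀ {k} → 2 ∣ k → ∀ t → neg^ k t ≡ t
  neg^-even (divides m ≡.refl) t = go m
    where
    go : ∀ m → neg^ (m ℕ.* 2) t ≡ t
    go zero    = ≡.refl
    go (suc m) = ≡.trans (neg-involutive _) (go m)

  even-or-odd : ∀ k → (2 ∣ k) ⊎ (2 ∣ suc k)
  even-or-odd zero    = inj₁ (divides 0 ≡.refl)
  even-or-odd (suc k) with even-or-odd k
  ... | inj₁ (divides m e) = inj₂ (divides (suc m) (≡.cong (2 ℕ.+_) e))
  ... | inj₂ 2∣1+k         = inj₁ 2∣1+k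

  -- Positions are counted from 1 here, so that a position is the order of its minors.
  FollowsPattern‼ : ∀ {n} → Bool → ℕ → Vec SeprTerm n → Set
  FollowsPattern‼ {n} s k σ = ∀ j → 1 ℕ.≤ j → j ℕ.≤ n → σ ‼ j ≡ just (pattern⟨ s ⟩ k j)

  follows⇒follows‼ : ∀ {n} s k (σ : Vec SeprTerm n) → FollowsPattern s k σ → FollowsPattern‼ s k σ
  follows⇒follows‼ s k σ h (suc j) _ j<n = ≡.subst (λ j → σ ‼ suc j ≡ just (pattern⟨ s ⟩ k (suc j)))
    (Fin.toℕ-fromℕ< j<n) (≡.trans (‼-lookup σ (Fin.fromℕ< j<n)) (≡.cong just (h (Fin.fromℕ< j<n))))

  follows‼⇒follows : ∀ {n} s k (σ : Vec SeprTerm n) → FollowsPattern‼ s k σ → FollowsPattern s k σ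
  follows‼⇒follows s k σ h i = just-injective
    (≡.trans (≡.sym (‼-lookup σ i)) (h (suc (toℕ i)) (ℕ.s≤s ℕ.z≤n) (Fin.toℕ<n i)))

  allA⁻⇒replicate : ∀ {n} (σ : Vec SeprTerm n) → (∀ i → Vec.lookup σ i ≡ A⁻) → toList σ ≡ replicate n A⁻
  allA⁻⇒replicate []      h = ≡.refl
  allA⁻⇒replicate (x ∷ σ) h = ≡.cong₂ List._∷_ (h zero) (allA⁻⇒replicate σ (h ∘ suc))

  replicate⇒allA⁻ : ∀ {n} (σ : Vec SeprTerm n) b → toList σ ≡ replicate b A⁻ → ∀ i → Vec.lookup σ i ≡ A⁻
  replicate⇒allA⁻ (x ∷ σ) (suc b) e zero    = List.∷-injectiveˡ e
  replicate⇒allA⁻ (x ∷ σ) (suc b) e (suc i) = replicate⇒allA⁻ σ b (List.∷-injectiveʳ e) i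

  -- Positions start at 0 and orders at 1, hence `suc q` in place of k = q + 2. Removing a leading
  -- `A⁺` lowers `q` and every position by one.
  differences⇒A⁺NA⁻A⁻ : ∀ {n} q (σ : Vec SeprTerm n) → 4 ℕ.+ q ℕ.≤ n →
    (∀ i → Vec.lookup σ i ≡ signOfDifference (suc q) (toℕ i)) → IsA⁺NA⁻A⁻ σ
  differences⇒A⁺NA⁻A⁻ zero (x ∷ y ∷ z ∷ u ∷ σ) _ h = 0 , _ ,
    ≡.cong₂ List._∷_ (h zero) (≡.cong₂ List._∷_ (h (suc zero)) (≡.cong₂ List._∷_ (h (suc (suc zero)))
      (≡.cong₂ List._∷_ (h (suc (suc (suc zero)))) (allA⁻⇒replicate σ λ i → h (suc (suc (suc (suc i))))))))
  differences⇒A⁺NA⁻A⁻ zero (x ∷ [])         (ℕ.s≤s ())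
  differences⇒A⁺NA⁻A⁻ zero (x ∷ y ∷ [])     (ℕ.s≤s (ℕ.s≤s ()))
  differences⇒A⁺NA⁻A⁻ zero (x ∷ y ∷ z ∷ []) (ℕ.s≤s (ℕ.s≤s (ℕ.s≤s ())))
  differences⇒A⁺NA⁻A⁻ (suc q) (x ∷ σ) (ℕ.s≤s q≤n) h with differences⇒A⁺NA⁻A⁻ q σ q≤n (h ∘ suc)
  ... | a , b , e = suc a , b , ≡.cong₂ List._∷_ (h zero) e

  A⁺NA⁻A⁻⇒differences : ∀ {n} a b (σ : Vec SeprTerm n) →
    toList σ ≡ replicate a A⁺ ++ (A⁺ List.∷ N List.∷ A⁻ List.∷ A⁻ List.∷ List.[]) ++ replicate b A⁻ →
    ∀ i → Vec.lookup σ i ≡ signOfDifference (suc a) (toℕ i)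
  A⁺NA⁻A⁻⇒differences zero b (x ∷ [])         ()
  A⁺NA⁻A⁻⇒differences zero b (x ∷ y ∷ [])     ()
  A⁺NA⁻A⁻⇒differences zero b (x ∷ y ∷ z ∷ []) ()
  A⁺NA⁻A⁻⇒differences zero b (x ∷ y ∷ z ∷ u ∷ σ) e = λ
    { zero                         → List.∷-injectiveˡ e
    ; (suc zero)                   → List.∷-injectiveˡ e₁
    ; (suc (suc zero))             → List.∷-injectiveˡ e₂
    ; (suc (suc (suc zero)))       → List.∷-injectiveˡ e₃
    ; (suc (suc (suc (suc i))))    → replicate⇒allA⁻ σ b (List.∷-injectiveʳ e₃) i
    }
    where
    e₁ = List.∷-injectiveʳ e
    e₂ = List.∷-injectiveʳ e₁
    e₃ = List.∷-injectiveʳ e₂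
  A⁺NA⁻A⁻⇒differences (suc a) b (x ∷ σ) e zero    = List.∷-injectiveˡ e
  A⁺NA⁻A⁻⇒differences (suc a) b (x ∷ σ) e (suc i) = A⁺NA⁻A⁻⇒differences a b σ (List.∷-injectiveʳ e) i

  -- Form (1) leaves the number `a` free, but its only `N` stands at position a + 2, and an `N` is
  -- known to stand at k.
  A⁺NA⁻A⁻⇒follows : ∀ {n} q (σ : Vec SeprTerm n) → epr σ ‼ (2 ℕ.+ q) ≡ just N →
    IsA⁺NA⁻A⁻ σ → FollowsPattern false (2 ℕ.+ q) σ
  A⁺NA⁻A⁻⇒follows q σ e₂ (a , b , e) = ≡.subst (λ a → ∀ i → Vec.lookup σ i ≡ signOfDifference (suc a)
      (toℕ i))
    a≡q (A⁺NA⁻A⁻⇒differences a b σ e)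
    where
    underlying-N : ∀ t → underlying t ≡ N → t ≡ N
    underlying-N N _ = ≡.refl
    a≡q : a ≡ q
    a≡q with ‼-epr σ (2 ℕ.+ q) e₂
    ... | i , 2+q≡ , u = signOfDifference-N a q (≡.trans
      (≡.cong (signOfDifference (suc a)) (ℕ.suc-injective 2+q≡))
      (≡.trans (≡.sym (A⁺NA⁻A⁻⇒differences a b σ e i)) (underlying-N _ u)))

  follows⇒negates : ∀ {n} q (σ : Vec SeprTerm n) → FollowsPattern‼ true (2 ℕ.+ q) σ →
      NegatesOffANA σ (2 ℕ.+ q)
  follows⇒negates {suc n} q σ h (suc i) (_ , i≤n , i≢k-1 , i≢k) = ≡.trans
    (h (2 ℕ.+ i) (ℕ.s≤s ℕ.z≤n) (ℕ.s≤s i≤n))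
    (≡.trans (≡.cong (λ t → just (neg^ (2 ℕ.+ i) t))
        (signOfDifference-step (2 ℕ.+ q) (suc i) (i≢k-1 ∘ ℕ.suc-injective) i≢k))
      (≡.cong (Maybe.map neg) (≡.sym (h (suc i) (ℕ.s≤s ℕ.z≤n) (ℕ.m≤n⇒m≤1+n i≤n)))))
  follows⇒negates {zero} q σ h (suc i) (_ , () , _)

  -- Propagation outwards from k. The set α lacks the steps from k - 1 and from k, so the terms at k
  -- - 1, k and k + 1 are supplied together and then carried to both ends.
  negates⇒follows : ∀ {n} q (σ : Vec SeprTerm n) → 4 ℕ.+ q ℕ.≤ n →
    (∀ j → 1 ℕ.+ q ℕ.≤ j → j ℕ.≤ 3 ℕ.+ q → σ ‼ j ≡ just (pattern⟨ true ⟩ (2 ℕ.+ q) j)) →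
    NegatesOffANA σ (2 ℕ.+ q) → FollowsPattern‼ true (2 ℕ.+ q) σ
  negates⇒follows {n} q σ q≤n block negates j 1≤j j≤n with ℕ.≤-total j (2 ℕ.+ q)
  ... | inj₁ j≤k = down (2 ℕ.+ q ℕ.∸ j) j 1≤j (ℕ.m∸n+n≡m j≤k)
    where
    p : ℕ → SeprTerm
    p = pattern⟨ true ⟩ (2 ℕ.+ q)
    -- Towards smaller orders the negation rule is read backwards, `neg` being an involution.
    un-neg : ∀ m t → Maybe.map neg m ≡ just (neg t) → m ≡ just t
    un-neg (just u) t e = ≡.cong just (≡.trans (≡.sym (neg-involutive u))
        (≡.trans (≡.cong neg (just-injective e)) (neg-involutive t)))
    down : ∀ d j → 1 ℕ.≤ j → d ℕ.+ j ≡ 2 ℕ.+ q → σ ‼ j ≡ just (p j)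
    down zero    j _ ≡.refl = block (2 ℕ.+ q) (ℕ.n≤1+n _) (ℕ.n≤1+n _)
    down (suc zero) j _ ≡.refl = block (1 ℕ.+ q) ℕ.≤-refl (ℕ.m≤n+m (1 ℕ.+ q) 2)
    down (suc (suc d)) j 1≤j e = un-neg (σ ‼ j) (p j) (≡.trans
      (≡.sym (negates j (1≤j , ℕ.<⇒≤pred (ℕ.<-≤-trans j<k-1 (ℕ.≤-trans (ℕ.m≤n+m (1 ℕ.+ q) 3) q≤n)) ,
          ℕ.<⇒≢ j<k-1 , ℕ.<⇒≢ (ℕ.m<n⇒m<1+n j<k-1))))
      (≡.trans (down (suc d) (suc j) (ℕ.s≤s ℕ.z≤n) (≡.trans (≡.cong suc (ℕ.+-suc d j)) e))
        (≡.cong (λ t → just (neg^ (suc j) t)) (signOfDifference-step (2 ℕ.+ q) j (ℕ.<⇒≢ (ℕ.s≤s j<k-1))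
            (ℕ.<⇒≢ (ℕ.m<n⇒m<1+n j<k-1))))))
      where
      j<k-1 : j ℕ.< 1 ℕ.+ q
      j<k-1 = ≡.subst (j ℕ.<_) (ℕ.suc-injective e) (ℕ.s≤s (ℕ.m≤n+m j d))
  ... | inj₂ k≤j = up (j ℕ.∸ (2 ℕ.+ q)) j j≤n (ℕ.m∸n+n≡m k≤j)
    where
    p : ℕ → SeprTerm
    p = pattern⟨ true ⟩ (2 ℕ.+ q)
    up : ∀ d j → j ℕ.≤ n → d ℕ.+ (2 ℕ.+ q) ≡ j → σ ‼ j ≡ just (p j)
    up zero       _ _   ≡.refl = block (2 ℕ.+ q) (ℕ.n≤1+n _) (ℕ.n≤1+n _)
    up (suc zero) _ _   ≡.refl = block (3 ℕ.+ q) (ℕ.m≤n+m (1 ℕ.+ q) 2) ℕ.≤-refl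
    up (suc (suc d)) (suc j) j≤n e = ≡.trans
      (negates j (ℕ.≤-trans (ℕ.s≤s ℕ.z≤n) k<j , ℕ.<⇒≤pred j≤n ,
          (λ j≡ → ℕ.<⇒≢ (ℕ.<-trans (ℕ.n<1+n _) k<j) (≡.sym j≡)) , (λ j≡ → ℕ.<⇒≢ k<j (≡.sym j≡))))
      (≡.trans (≡.cong (Maybe.map neg) (up (suc d) j (ℕ.<⇒≤ j≤n) (ℕ.suc-injective e)))
        (≡.cong (λ t → just (neg^ (suc j) t)) (≡.sym (signOfDifference-step (2 ℕ.+ q) j
          (λ sj≡ → ℕ.<⇒≢ (ℕ.m<n⇒m<1+n k<j) (≡.sym sj≡)) (λ j≡ → ℕ.<⇒≢ k<j (≡.sym j≡))))))
      where
      k<j : 2 ℕ.+ q ℕ.< j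
      k<j = ≡.subst (2 ℕ.+ q ℕ.<_) (ℕ.suc-injective e) (ℕ.s≤s (ℕ.m≤n+m (2 ℕ.+ q) d))

  pattern-k-1 : ∀ q → pattern⟨ true ⟩ (2 ℕ.+ q) (1 ℕ.+ q) ≡ neg^ (1 ℕ.+ q) A⁺
  pattern-k-1 q = ≡.cong (neg^ (1 ℕ.+ q)) (signOfDifference-pred (1 ℕ.+ q))

  pattern-k : ∀ q → pattern⟨ true ⟩ (2 ℕ.+ q) (2 ℕ.+ q) ≡ neg^ (2 ℕ.+ q) N
  pattern-k q = ≡.cong (neg^ (2 ℕ.+ q)) (signOfDifference-refl (2 ℕ.+ q))

  pattern-k+ : ∀ q d → pattern⟨ true ⟩ (2 ℕ.+ q) (3 ℕ.+ d ℕ.+ q) ≡ neg^ (3 ℕ.+ d ℕ.+ q) A⁻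
  pattern-k+ q d = ≡.cong (neg^ (3 ℕ.+ d ℕ.+ q)) (≡.trans
    (≡.cong (signOfDifference q) (≡.cong suc (ℕ.+-comm d q)))
    (≡.trans (≡.cong (signOfDifference q) (≡.sym (ℕ.+-suc q d))) (signOfDifference-> q d)))

  2∣q⇒2∣2+q : ∀ {q} → 2 ∣ q → 2 ∣ 2 ℕ.+ q
  2∣q⇒2∣2+q (divides m e) = divides (suc m) (≡.cong (2 ℕ.+_) e)

  2∣2+q⇒2∣q : ∀ {q} → 2 ∣ 2 ℕ.+ q → 2 ∣ q
  2∣2+q⇒2∣q 2∣2+q = ∣m+n∣m⇒∣n 2∣2+q ∣-refl

  odd⇒¬even : ∀ {q} → 2 ∣ suc q → ¬ 2 ∣ q
  odd⇒¬even {q} 2∣1+q 2∣q with ∣m+n∣m⇒∣n (≡.subst (2 ∣_) (ℕ.+-comm 1 q) 2∣1+q) 2∣q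
  ... | divides zero ()
  ... | divides (suc m) ()

  follows⇒block : ∀ {n} q (σ : Vec SeprTerm n) → 4 ℕ.+ q ℕ.≤ n → FollowsPattern‼ true (2 ℕ.+ q) σ →
    HasBlock σ (2 ℕ.+ q) (neg^ (1 ℕ.+ q) A⁺) (neg^ (2 ℕ.+ q) N) (neg^ (3 ℕ.+ q) A⁻) (neg^ (4 ℕ.+ q) A⁻)
  follows⇒block {n} q σ q≤n h =
    ≡.trans (h _ (ℕ.s≤s ℕ.z≤n) (ℕ.≤-trans (ℕ.m≤n+m _ 3) q≤n)) (≡.cong just (pattern-k-1 q)) ,
    ≡.trans (h _ (ℕ.s≤s ℕ.z≤n) (ℕ.≤-trans (ℕ.m≤n+m _ 2) q≤n)) (≡.cong just (pattern-k q)) ,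
    ≡.trans (≡.cong (σ ‼_) (ℕ.+-comm (2 ℕ.+ q) 1))
      (≡.trans (h _ (ℕ.s≤s ℕ.z≤n) (ℕ.≤-trans (ℕ.m≤n+m _ 1) q≤n)) (≡.cong just (pattern-k+ q 0))) ,
    ≡.trans (≡.cong (σ ‼_) (ℕ.+-comm (2 ℕ.+ q) 2))
      (≡.trans (h _ (ℕ.s≤s ℕ.z≤n) q≤n) (≡.cong just (pattern-k+ q 1)))

  block⇒follows : ∀ {n} q (σ : Vec SeprTerm n) {t} → 4 ℕ.+ q ℕ.≤ n →
    HasBlock σ (2 ℕ.+ q) (neg^ (1 ℕ.+ q) A⁺) (neg^ (2 ℕ.+ q) N) (neg^ (3 ℕ.+ q) A⁻) t →
    NegatesOffANA σ (2 ℕ.+ q) → FollowsPattern true (2 ℕ.+ q) σ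
  block⇒follows q σ q≤n (e₁ , e₂ , e₃ , _) negates =
    follows‼⇒follows true (2 ℕ.+ q) σ (negates⇒follows q σ q≤n block negates)
    where
    block : ∀ j → 1 ℕ.+ q ℕ.≤ j → j ℕ.≤ 3 ℕ.+ q → σ ‼ j ≡ just (pattern⟨ true ⟩ (2 ℕ.+ q) j)
    block j lo hi with ℕ.m≤n⇒m<n∨m≡n lo
    ... | inj₂ ≡.refl = ≡.trans e₁ (≡.cong just (≡.sym (pattern-k-1 q)))
    ... | inj₁ lo′ with ℕ.m≤n⇒m<n∨m≡n lo′
    ... | inj₂ ≡.refl = ≡.trans e₂ (≡.cong just (≡.sym (pattern-k q)))
    ... | inj₁ lo″ with ℕ.≤-antisym lo″ hi
    ... | ≡.refl = ≡.trans (≡.cong (σ ‼_) (≡.sym (ℕ.+-comm (2 ℕ.+ q) 1)))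
        (≡.trans e₃ (≡.cong just (≡.sym (pattern-k+ q 0))))

  -- An even number of negations cancels, which leaves 0, 1, 2 and 3 of them along the block. An
  -- equality of types can be transported in both directions.
  block-odd : ∀ {n} q (σ : Vec SeprTerm n) → 2 ∣ suc q →
    HasBlock σ (2 ℕ.+ q) (neg^ (1 ℕ.+ q) A⁺) (neg^ (2 ℕ.+ q) N) (neg^ (3 ℕ.+ q) A⁻) (neg^ (4 ℕ.+ q) A⁻) ≡
    HasBlock σ (2 ℕ.+ q) A⁺ N A⁻ A⁺
  block-odd q σ 2∣1+q
    rewrite neg^-even 2∣1+q A⁺ | neg^-even 2∣1+q N | neg^-even 2∣1+q A⁻ = ≡.refl

  block-even : ∀ {n} q (σ : Vec SeprTerm n) → 2 ∣ q →
    HasBlock σ (2 ℕ.+ q) (neg^ (1 ℕ.+ q) A⁺) (neg^ (2 ℕ.+ q) N) (neg^ (3 ℕ.+ q) A⁻) (neg^ (4 ℕ.+ q) A⁻) ≡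
    HasBlock σ (2 ℕ.+ q) A⁻ N A⁺ A⁻
  block-even q σ 2∣q
    rewrite neg^-even 2∣q A⁺ | neg^-even 2∣q N | neg^-even 2∣q A⁻ = ≡.refl

-- The equivalence, by pattern and by the parity of k

open SeprSequences
open import Defs
open import Data.Bool.Base using (true; false)
open import Data.Nat.Base using (ℕ; _+_; _∸_; _≤_)
open import Data.Nat.Divisibility using (_∣_)
open import Data.Maybe.Base using (just)
open import Data.Product.Base using (∃-syntax; _×_)
open import Data.Sum.Base using (_⊎_)
open import Data.Vec.Base using (Vec)
open import Function.Bundles using (_⇔_; mk⇔)
open import Relation.Binary.PropositionalEquality using (_≡_)
open import Relation.Nullary.Negation using (¬_)

theorem5p6 : (n k : ℕ) (σ : Vec SeprTerm n) →
    2 ≤ k → k ≤ n ∸ 2 →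
    epr σ ‼ (k ∸ 1) ≡ just A → epr σ ‼ k ≡ just N → epr σ ‼ (k + 1) ≡ just A →
    (∃[ B ] (Symmetric {n} B × HasSepr B σ))
    ⇔
    ( IsA⁺NA⁻A⁻ σ
    ⊎ (¬ 2 ∣ k × HasBlock σ k A⁺ N A⁻ A⁺ × NegatesOffANA σ k)
    ⊎ (2 ∣ k × HasBlock σ k A⁻ N A⁺ A⁻ × NegatesOffANA σ k) )
theorem5p6 (suc (suc m)) (suc (suc q)) σ (ℕ.s≤s (ℕ.s≤s ℕ.z≤n)) k≤m e₁ e₂ e₃ = mk⇔ only-if if
  where
  -- With k = q + 2 and n = m + 2 this is k + 2 ≤ n.
  q≤n : 4 ℕ.+ q ℕ.≤ 2 ℕ.+ m
  q≤n = ℕ.s≤s (ℕ.s≤s k≤m)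
  only-if : ∃[ B ] (Symmetric B × HasSepr B σ) → _
  only-if (B , B-sym , σ-sepr) with sepr⇒pattern {q} σ B q≤n e₁ e₂
    (≡.subst (λ j → epr σ ‼ j ≡ just A) (ℕ.+-comm (2 ℕ.+ q) 1) e₃) B-sym σ-sepr
  ... | false , h = inj₁ (differences⇒A⁺NA⁻A⁻ q σ q≤n h)
  -- The pattern of J - k I takes the form (2) or (3) according to the parity of k, which is that of
  -- `q`.
  ... | true  , h with follows⇒follows‼ true (2 ℕ.+ q) σ h | even-or-odd q
  ... | h‼ | inj₁ 2∣q   = inj₂ (inj₂ (2∣q⇒2∣2+q 2∣q ,
    ≡.subst (λ X → X) (block-even q σ 2∣q) (follows⇒block q σ q≤n h‼) , follows⇒negates q σ h‼))
  ... | h‼ | inj₂ 2∣1+q = inj₂ (inj₁ ((λ 2∣k → odd⇒¬even 2∣1+q (2∣2+q⇒2∣q 2∣k)) ,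
    ≡.subst (λ X → X) (block-odd q σ 2∣1+q) (follows⇒block q σ q≤n h‼) , follows⇒negates q σ h‼))
  if : _ → ∃[ B ] (Symmetric B × HasSepr B σ)
  if (inj₁ h) = pattern⇒sepr false (1 ℕ.+ q) σ (A⁺NA⁻A⁻⇒follows q σ e₂ h)
  if (inj₂ (inj₁ (¬2∣k , block , negates))) with even-or-odd q
  ... | inj₁ 2∣q   = contradiction (2∣q⇒2∣2+q 2∣q) ¬2∣k
  ... | inj₂ 2∣1+q = pattern⇒sepr true (1 ℕ.+ q) σ
    (block⇒follows q σ q≤n (≡.subst (λ X → X) (≡.sym (block-odd q σ 2∣1+q)) block) negates)
  if (inj₂ (inj₂ (2∣k , block , negates))) = pattern⇒sepr true (1 ℕ.+ q) σ
    (block⇒follows q σ q≤n (≡.subst (λ X → X) (≡.sym (block-even q σ (2∣2+q⇒2∣q 2∣k))) block) negates)
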